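{- Let $\mathcal P$ be a hereditary permutation property and let $\epsilon>0$. Let $$M=\left\lceil\frac{20000}{\epsilon^2}\right\rceil,\qquad n_0=\frac{32M^5k^*(M)}{\epsilon^3}.$$ Then there is a two-sided tester for $\mathcal P$ with respect to the planar tau distance, with parameter $\epsilon$ and query complexity $M$, for permutations of length at least $n_0$.
   Context: A permutation $\pi$ of length $n=|\pi|\ge1$ is a bijection $[n]\to[n]$, $[n]=\{1,\dots,n\}$. A permutation $\sigma$ of length $k$ is a subpermutation of $\pi$ if there are $i_1<\dots<i_k$ in $[n]$ with $\pi(i_j)<\pi(i_\ell)$ iff $\sigma(j)<\sigma(\ell)$. A permutation property is a family $\mathcal P$ of permutations; it is hereditary if every subpermutation of a member is a member. Blow-ups. A permutation $\alpha'$ is a blow-up of $\alpha$ if there are integers $1=k_1<k_2<\dots<k_{|\alpha|+1}=|\alpha'|+1$ such that whenever $k_{j_1}\le i_1<k_{j_1+1}$ and $k_{j_2}\le i_2<k_{j_2+1}$ with $j_1\ne j_2$, one has $\alpha'(i_1)>\alpha'(i_2)$ iff $\alpha(j_1)>\alpha(j_2)$. The $j$-th block has size $k_{j+1}-k_j$; the pattern inside each block is arbitrary. A $k$-blow-up is a blow-up in which every block has size $k$. For a permutation $\alpha$, $k^*(\alpha)$ is the least positive integer $k$ such that no $k$-blow-up of $\alpha$ is in $\mathcal P$, and $k^*(\alpha)=\infty$ if there is none. For a positive integer $T$, $k^*(T)$ is the maximum of $k^*(\alpha)$ over permutations $\alpha$ of length $T$ with $k^*(\alpha)<\infty$, and $k^*(T)=\infty$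 if there is no such $\alpha$. (If $n_0=\infty$ the assertion is vacuous.) Planar tau distance. $\sigma$ is obtained from $\pi$ (both of length $n$) by a planar simple transposition if for some $1\le i\le n-1$ either $\sigma$ equals $\pi$ except $\sigma(i)=\pi(i+1)$, $\sigma(i+1)=\pi(i)$, or $\sigma^{ -1}$ equals $\pi^{ -1}$ except $\sigma^{ -1}(i)=\pi^{ -1}(i+1)$, $\sigma^{ -1}(i+1)=\pi^{ -1}(i)$. $\rho_{\mathrm{PT}}(\pi_1,\pi_2)$ is $1/\binom n2$ times the minimum number of planar simple transpositions transforming $\pi_1$ into $\pi_2$ (and $0$ if $n=1$). The distance of $\pi$ from $\mathcal P$ is $\min\rho_{\mathrm{PT}}(\pi,\pi_0)$ over $\pi_0\in\mathcal P$ with $|\pi_0|=|\pi|$, and is $1$ if there is no such $\pi_0$; $\pi$ is $\epsilon$-far from $\mathcal P$ if this distance is greater than $\epsilon$. Testers. A two-sided tester for $\mathcal P$ (with parameter $\epsilon$) of query complexity $q$, for permutations of length at least $n_0$, is a randomized algorithm (which may depend on $\mathcal P$ and $\epsilon$; only queries are counted) that, for each permutation $\pi$ of length $n\ge n_0$, queries at most $q$ positions of $\pi$ and outputs either "$\pi\in\mathcal P$" or "$\pi\notin\mathcal P$", such that: if $\pi\in\mathcal P$ it outputs "$\pi\in\mathcal P$" with probability at least $2/3$, and if $\pi$ is $\epsilon$-far from $\mathcal P$ it outputs "$\pi\notin\mathcal P$" with probability at least $2/3$. -}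

module Defs where

open import Algebra.Properties.CommutativeMonoid.Sum using (sum)
open import Data.Bool using (Bool; true; false; if_then_else_)
import Data.Bool as Bool
open import Data.Fin as Fin using (Fin; toℕ; inject₁; fromℕ)
open import Data.Fin.Permutation using (Permutation′; _⟨$⟩ʳ_; _⟨$⟩ˡ_; _≈_)
open import Data.Integer as ℤ using (+_)
open import Data.Nat as ℕ using (ℕ; zero; suc)
open import Data.Nat.Combinatorics using (_C_)
open import Data.Product using (∃-syntax; Σ-syntax; _×_; _,_)
open import Data.Rational as ℚ using (ℚ; 0ℚ; 1ℚ)
import Data.Rational.Properties as ℚ
open import Data.Rational.Literals using (fromℤ)
open import Data.Sum using (_⊎_; inj₁; inj₂)
open import Function using (_⇔_)
open import Relation.Binary.PropositionalEquality
  using (_≡_; _≢_; refl; sym; subst)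
open import Relation.Nullary using (¬_; does)

IsLeast : (ℕ → Set) → ℕ → Set
IsLeast Q k = Q k × (∀ j → Q j → k ℕ.≤ j)

-- Non-negative reals as classical (one-sided) Dedekind cuts: x is given by the
-- set of rationals strictly below it.  No locatedness is required, so
-- these are the usual reals only in the presence of excluded middle.

record ℝ≥0 : Set₁ where
  no-eta-equality
  field
    Below    : ℚ → Set
    negative : ∀ {q} → q ℚ.< 0ℚ → Below q
    lower    : ∀ {p q} → p ℚ.< q → Below q → Below p
    rounded  : ∀ {p} → Below p → ∃[ q ] p ℚ.< q × Below q
    bounded  : ∃[ q ] ¬ Below q

open ℝ≥0

record Positive (x : ℝ≥0) : Set where
  constructor pos
  field 0<x : Below x 0ℚ

open Positive

infix 4 _≤ᵣ_ _<ℚ_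

_≤ᵣ_ : ℝ≥0 → ℝ≥0 → Set
x ≤ᵣ y = ∀ q → Below x q → Below y q

_<ℚ_ : ℝ≥0 → ℚ → Set
x <ℚ q = ∃[ p ] p ℚ.< q × ¬ Below x p

private
  <⇒≱ : ∀ {p q} → p ℚ.< q → ¬ (q ℚ.≤ p)
  <⇒≱ p<q q≤p = ℚ.<-irrefl refl (ℚ.<-≤-trans p<q q≤p)

  out-≥0 : ∀ x {s} → ¬ Below x s → 0ℚ ℚ.≤ s
  out-≥0 x s∉ = ℚ.≮⇒≥ (λ s<0 → s∉ (negative x s<0))

  out-≥ : ∀ x {a s} → Below x a → ¬ Below x s → a ℚ.≤ s
  out-≥ x a∈ s∉ = ℚ.≮⇒≥ (λ s<a → s∉ (lower x s<a a∈))

  out->0 : ∀ x {s} → Positive x → ¬ Below x s → 0ℚ ℚ.< s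
  out->0 x (pos 0∈) s∉ with rounded x 0∈
  ... | _ , 0<q , q∈ = ℚ.<-≤-trans 0<q (out-≥ x q∈ s∉)

  *-≤ : ∀ {a b s t} → 0ℚ ℚ.≤ b → 0ℚ ℚ.≤ s → a ℚ.≤ s → b ℚ.≤ t → a ℚ.* b ℚ.≤ s ℚ.* t
  *-≤ {a} {b} {s} {t} 0≤b 0≤s a≤s b≤t = ℚ.≤-trans
    (ℚ.*-monoʳ-≤-nonNeg b {{ℚ.nonNegative 0≤b}} a≤s)
    (ℚ.*-monoˡ-≤-nonNeg s {{ℚ.nonNegative 0≤s}} b≤t)

  *-≥0 : ∀ {s t} → 0ℚ ℚ.≤ s → 0ℚ ℚ.≤ t → 0ℚ ℚ.≤ s ℚ.* t
  *-≥0 {s} {t} 0≤s 0≤t = subst (ℚ._≤ s ℚ.* t) (ℚ.*-zeroˡ 0ℚ) (*-≤ ℚ.≤-refl 0≤s 0≤s 0≤t)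

  reciprocal : ∀ {s} → 0ℚ ℚ.< s → ∃[ r ] r ℚ.* s ≡ 1ℚ
  reciprocal {s} 0<s = ℚ.1/_ s {{nz}} , ℚ.*-inverseˡ s {{nz}}
    where nz = ℚ.pos⇒nonZero s {{ℚ.positive 0<s}}

fromℕᵣ : ℕ → ℝ≥0
fromℕᵣ n .Below q = q ℚ.< fromℤ (+ n)
fromℕᵣ n .negative q<0 = ℚ.<-≤-trans q<0 (ℚ.nonNegative⁻¹ (fromℤ (+ n)))
fromℕᵣ n .lower = ℚ.<-trans
fromℕᵣ n .rounded q<n = let m , q<m , m<n = ℚ.<-dense q<n in m , q<m , m<n
fromℕᵣ n .bounded = fromℤ (+ n) , ℚ.<-irrefl refl

infixl 7 _*ᵣ_ _/ᵣ_
infixr 8 _^ᵣ_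

_*ᵣ_ : ℝ≥0 → ℝ≥0 → ℝ≥0
(x *ᵣ y) .Below q =
  q ℚ.< 0ℚ ⊎ (∃[ a ] ∃[ b ] 0ℚ ℚ.≤ a × 0ℚ ℚ.≤ b × Below x a × Below y b × q ℚ.< a ℚ.* b)
(x *ᵣ y) .negative = inj₁
(x *ᵣ y) .lower p<q (inj₁ q<0) = inj₁ (ℚ.<-trans p<q q<0)
(x *ᵣ y) .lower p<q (inj₂ (a , b , 0≤a , 0≤b , a∈ , b∈ , q<ab)) =
  inj₂ (a , b , 0≤a , 0≤b , a∈ , b∈ , ℚ.<-trans p<q q<ab)
(x *ᵣ y) .rounded (inj₁ q<0) = let m , q<m , m<0 = ℚ.<-dense q<0 in m , q<m , inj₁ m<0
(x *ᵣ y) .rounded (inj₂ (a , b , 0≤a , 0≤b , a∈ , b∈ , q<ab)) =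
  let m , q<m , m<ab = ℚ.<-dense q<ab
  in m , q<m , inj₂ (a , b , 0≤a , 0≤b , a∈ , b∈ , m<ab)
(x *ᵣ y) .bounded with bounded x | bounded y
... | s , s∉ | t , t∉ = s ℚ.* t , λ
  { (inj₁ st<0) → <⇒≱ st<0 (*-≥0 (out-≥0 x s∉) (out-≥0 y t∉))
  ; (inj₂ (a , b , 0≤a , 0≤b , a∈ , b∈ , st<ab)) →
      <⇒≱ st<ab (*-≤ 0≤b (out-≥0 x s∉) (out-≥ x a∈ s∉) (out-≥ y b∈ t∉))
  }

_^ᵣ_ : ℝ≥0 → ℕ → ℝ≥0
x ^ᵣ zero  = fromℕᵣ 1
x ^ᵣ suc n = x *ᵣ x ^ᵣ n

-- q < 1/x  iff  q < 1/s for some rational s ≥ x.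
inverse : (x : ℝ≥0) → Positive x → ℝ≥0
inverse x x>0 .Below q = ∃[ s ] ¬ Below x s × q ℚ.* s ℚ.< 1ℚ
inverse x x>0 .negative {q} q<0 =
  let s , s∉ = bounded x
      qs≤0s = ℚ.*-monoʳ-≤-nonNeg s {{ℚ.nonNegative (out-≥0 x s∉)}} (ℚ.<⇒≤ q<0)
  in s , s∉ , ℚ.≤-<-trans (subst (q ℚ.* s ℚ.≤_) (ℚ.*-zeroˡ s) qs≤0s) (ℚ.positive⁻¹ 1ℚ)
inverse x x>0 .lower p<q (s , s∉ , qs<1) = s , s∉ ,
  ℚ.≤-<-trans (ℚ.*-monoʳ-≤-nonNeg s {{ℚ.nonNegative (out-≥0 x s∉)}} (ℚ.<⇒≤ p<q)) qs<1
inverse x x>0 .rounded {q} (s , s∉ , qs<1) =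
  let 0<s = out->0 x x>0 s∉
      r , rs≡1 = reciprocal 0<s
      q<r = ℚ.*-cancelʳ-<-nonNeg s {{ℚ.nonNegative (ℚ.<⇒≤ 0<s)}} {q} {r}
              (subst (q ℚ.* s ℚ.<_) (sym rs≡1) qs<1)
      m , q<m , m<r = ℚ.<-dense q<r
  in m , q<m , s , s∉ ,
     subst (m ℚ.* s ℚ.<_) rs≡1 (ℚ.*-monoˡ-<-pos s {{ℚ.positive 0<s}} m<r)
inverse x x>0 .bounded with rounded x (x>0 .0<x)
... | a , 0<a , a∈ = r , λ { (s , s∉ , rs<1) → <⇒≱ rs<1 (1≤rs s∉) }
  where
  instance
    a-pos : ℚ.Positive a
    a-pos = ℚ.positive 0<a
    a-nz : ℚ.NonZero a
    a-nz = ℚ.pos⇒nonZero a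
  r = ℚ.1/ a
  1≤rs : ∀ {s} → ¬ Below x s → 1ℚ ℚ.≤ r ℚ.* s
  1≤rs {s} s∉ = subst (ℚ._≤ r ℚ.* s) (ℚ.*-inverseˡ a)
    (ℚ.*-monoˡ-≤-nonNeg r {{ℚ.pos⇒nonNeg r {{ℚ.1/pos⇒pos a}}}} (out-≥ x a∈ s∉))

_/ᵣ_ : (x y : ℝ≥0) → {{Positive y}} → ℝ≥0
_/ᵣ_ x y {{y>0}} = x *ᵣ inverse y y>0

instance
  1-positive : Positive (fromℕᵣ 1)
  1-positive = pos {fromℕᵣ 1} (ℚ.positive⁻¹ 1ℚ)

  *-positive : ∀ {x y} {{_ : Positive x}} {{_ : Positive y}} → Positive (x *ᵣ y)
  *-positive {x} {y} {{pos 0∈x}} {{pos 0∈y}} =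
    let a , 0<a , a∈ = rounded x 0∈x
        b , 0<b , b∈ = rounded y 0∈y
    in pos {x *ᵣ y} (inj₂ (a , b , ℚ.<⇒≤ 0<a , ℚ.<⇒≤ 0<b , a∈ , b∈ ,
         subst (ℚ._< a ℚ.* b) (ℚ.*-zeroˡ b) (ℚ.*-monoˡ-<-pos b {{ℚ.positive 0<b}} 0<a)))

IsCeiling : ℝ≥0 → ℕ → Set
IsCeiling x = IsLeast (λ m → x ≤ᵣ fromℕᵣ m)

-- Permutations of length n act on Fin n = {0, …, n-1}.  Lengths start at 1:
-- wherever the empty permutation could matter it is explicitly excluded, so the
-- value of a property on it is irrelevant.

PermutationProperty : Set₁
PermutationProperty = ∀ n → Permutation′ n → Set

infix 4 _⊑_

_⊑_ : ∀ {k n} → Permutation′ k → Permutation′ n → Set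
_⊑_ {k} {n} σ π = Σ[ ι ∈ (Fin k → Fin n) ]
    (∀ {j l} → j Fin.< l → ι j Fin.< ι l)
  × (∀ j l → (π ⟨$⟩ʳ ι j Fin.< π ⟨$⟩ʳ ι l) ⇔ (σ ⟨$⟩ʳ j Fin.< σ ⟨$⟩ʳ l))

Hereditary : PermutationProperty → Set
Hereditary P = ∀ {k n} (σ : Permutation′ k) (π : Permutation′ n) →
  1 ℕ.≤ k → σ ⊑ π → P n π → P k σ

-- Block j consists of the positions i with start j ≤ i < start (j + 1).
record BlowUp {m n} (α : Permutation′ m) (α′ : Permutation′ n) : Set where
  field
    start      : Fin (suc m) → ℕ
    first      : start Fin.zero ≡ 0
    last       : start (fromℕ m) ≡ n
    increasing : ∀ j → start (inject₁ j) ℕ.< start (Fin.suc j)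

  InBlock : Fin m → Fin n → Set
  InBlock j i = start (inject₁ j) ℕ.≤ toℕ i × toℕ i ℕ.< start (Fin.suc j)

  blockSize : Fin m → ℕ
  blockSize j = start (Fin.suc j) ℕ.∸ start (inject₁ j)

  field
    order : ∀ {j₁ j₂ i₁ i₂} → InBlock j₁ i₁ → InBlock j₂ i₂ → j₁ ≢ j₂ →
            (α′ ⟨$⟩ʳ i₁ Fin.> α′ ⟨$⟩ʳ i₂) ⇔ (α ⟨$⟩ʳ j₁ Fin.> α ⟨$⟩ʳ j₂)

IsUniformBlowUp : ℕ → ∀ {m n} → Permutation′ m → Permutation′ n → Set
IsUniformBlowUp k α α′ = ∃[ b ] (∀ j → BlowUp.blockSize {α = α} {α′ = α′} b j ≡ k)

-- k*(α) and k*(T) are given by their graphs over the finite values; the value ∞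
-- corresponds to there being no related natural number.

IsK* : PermutationProperty → ∀ {m} → Permutation′ m → ℕ → Set
IsK* P α = IsLeast λ k →
  1 ℕ.≤ k × (∀ n (α′ : Permutation′ n) → IsUniformBlowUp k α α′ → ¬ P n α′)

IsMaxK* : PermutationProperty → ℕ → ℕ → Set
IsMaxK* P T K =
    (∃[ α ] IsK* P {T} α K)
  × (∀ (α : Permutation′ T) k → IsK* P α k → k ℕ.≤ K)

AdjacentSwap : ∀ {n} → (Fin n → Fin n) → (Fin n → Fin n) → Set
AdjacentSwap f g = ∃[ i ] ∃[ i⁺ ]
    toℕ i⁺ ≡ suc (toℕ i)
  × g i ≡ f i⁺
  × g i⁺ ≡ f i
  × (∀ l → l ≢ i → l ≢ i⁺ → g l ≡ f l)

PlanarSimpleTransposition : ∀ {n} → Permutation′ n → Permutation′ n → Set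
PlanarSimpleTransposition π σ =
  AdjacentSwap (π ⟨$⟩ʳ_) (σ ⟨$⟩ʳ_) ⊎ AdjacentSwap (π ⟨$⟩ˡ_) (σ ⟨$⟩ˡ_)

data Path {n} : ℕ → Permutation′ n → Permutation′ n → Set where
  done : ∀ {π σ} → π ≈ σ → Path 0 π σ
  step : ∀ {t π τ σ} → PlanarSimpleTransposition π τ → Path t τ σ → Path (suc t) π σ

-- t / d, with value 0 for d = 0; for d = n C 2 the latter happens when n = 1.
ratio : ℕ → ℕ → ℚ
ratio t zero    = 0ℚ
ratio t (suc d) = + t ℚ./ suc d

-- ρ_PT π σ = d
IsPlanarTau : ∀ {n} → Permutation′ n → Permutation′ n → ℚ → Set
IsPlanarTau {n} π σ d = ∃[ t ] IsLeast (λ t → Path t π σ) t × d ≡ ratio t (n C 2)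

IsDistance : PermutationProperty → ∀ {n} → Permutation′ n → ℚ → Set
IsDistance P {n} π d =
    ((∃[ σ ] P n σ × IsPlanarTau π σ d)
      × (∀ σ e → P n σ → IsPlanarTau π σ e → d ℚ.≤ e))
  ⊎ ((∀ σ → ¬ P n σ) × d ≡ 1ℚ)

Far : PermutationProperty → ℝ≥0 → ∀ {n} → Permutation′ n → Set
Far P ε π = ∃[ d ] IsDistance P π d × ε <ℚ d

-- Randomized adaptive algorithms with query access to a permutation of length n
-- that make at most q queries.  A query of position i is answered by π(i); a
-- toss draws an element of Fin (suc k) uniformly and independently of the past;
-- the output true stands for "π ∈ P", false for "π ∉ P".
data Algorithm (n : ℕ) : ℕ → Set where
  output : ∀ {q} → Bool → Algorithm n q
  query  : ∀ {q} → Fin n → (Fin n → Algorithm n q) → Algorithm n (suc q)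
  toss   : ∀ {q} k → (Fin (suc k) → Algorithm n q) → Algorithm n q

probability : ∀ {n q} → Algorithm n q → Permutation′ n → Bool → ℚ
probability (output b)  π v = if does (b Bool.≟ v) then 1ℚ else 0ℚ
probability (query i f) π v = probability (f (π ⟨$⟩ʳ i)) π v
probability (toss k f)  π v =
  (+ 1 ℚ./ suc k) ℚ.* sum ℚ.+-0-commutativeMonoid (λ s → probability (f s) π v)

record Tester (P : PermutationProperty) (ε : ℝ≥0) (q : ℕ) (n₀ : ℝ≥0) : Set where
  field
    algorithm : ∀ n → Algorithm n q
    accepts   : ∀ {n} (π : Permutation′ n) → 1 ℕ.≤ n → n₀ ≤ᵣ fromℕᵣ n →
                P n π → + 2 ℚ./ 3 ℚ.≤ probability (algorithm n) π true
    rejects   : ∀ {n} (π : Permutation′ n) → 1 ℕ.≤ n → n₀ ≤ᵣ fromℕᵣ n →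
                Far P ε π → + 2 ℚ./ 3 ℚ.≤ probability (algorithm n) π false

-- The tester queries M / 2 random positions and accepts iff P contains arbitrarily reweighted
-- blow-ups, of length n, of the pattern it sees.
--
-- If π ∈ P, cut the square into M² by M² cells.  With probability at least 2/3 the sampled points
-- lie in distinct rows and columns and in cells with at least k*(M) points; such a sample extends
-- greedily to M points with the same property.  Choosing k points in each of their cells gives
-- k-blow-ups of the pattern α of the M points inside π for all k ≤ k*(M), so k*(α) = ∞, and P
-- contains n-blow-ups of α, from which every reweighting can be selected.
--
-- Conversely, let the weight of a sampled point be the number of points of π to which it is the
-- nearest.  Bubble sorting positions and values turns π into the reweighted blow-up with at most
-- 4 D transpositions, where D is the sum of the L¹ distances from the points of π to the sample.
-- The expected distance from a random point to the sample is that from one of M / 2 + 1 random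
-- points to its nearest neighbour among the others, and cutting the square into about 50 / ε strips
-- shows that this is small compared with ε n; so by Markov's inequality acceptance is unlikely when
-- π is far from P.

module Submission where

open import Algebra.Bundles using (CommutativeMonoid)
import Algebra.Properties.CommutativeMonoid.Sum as Sum
import Algebra.Properties.CommutativeSemigroup as CommutativeSemigroup
open import Axiom.ExcludedMiddle using (ExcludedMiddle)
open import Data.Bool as Bool using (Bool; true; false; if_then_else_)
open import Data.Fin as Fin
  using (Fin; toℕ; fromℕ<; inject₁; combine; quotient; remainder; punchOut; _↑ʳ_)
open import Data.Fin.Permutation
  using (Permutation′; _⟨$⟩ʳ_; _⟨$⟩ˡ_; _≈_; flip; _∘ₚ_; transpose; inverseˡ; inverseʳ; permutation)
import Data.Fin.Properties as Fin
import Data.Integer as ℤ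
import Data.Integer.Properties as ℤ
open import Data.Nat
open import Data.Nat.Combinatorics using (_C_; nC1≡n; nCk+nC[k+1]≡[n+1]C[k+1])
open import Data.Nat.DivMod
  using (_/_; _%_; m≡m%n+[m/n]*n; m%n<n; m<n*o⇒m/o<n; m/n*n≤m; /-monoˡ-≤)
open import Data.Nat.Induction using (<-rec)
open import Data.Nat.Properties
open import Data.Nat.Tactic.RingSolver using (solve-∀)
open import Data.Product using (Σ-syntax; ∃; ∃-syntax; _×_; _,_; proj₁; proj₂)
open import Data.Rational as ℚ using (ℚ; mkℚ; 0ℚ; 1ℚ; toℚᵘ)
open import Data.Rational.Literals using (fromℤ)
import Data.Rational.Properties as ℚ
open import Data.Rational.Unnormalised using (mkℚᵘ; *≡*)
import Data.Rational.Unnormalised.Properties as ℚᵘ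
open import Data.Sum as Sum⊎ using (_⊎_; inj₁; inj₂)
open import Data.Unit using (⊤; tt)
open import Data.Vec using (Vec; []; _∷_; lookup; insertAt; removeAt; map; _++_)
open import Data.Vec.Properties
  using (insertAt-lookup; removeAt-insertAt; removeAt-punchOut; lookup-++ʳ; lookup-map)
open import Function using (_∘_; _⇔_; mk⇔; Equivalence)
open import Level using (0ℓ)
open import Relation.Binary.Definitions using (tri<; tri≈; tri>)
open import Relation.Binary.PropositionalEquality
open import Relation.Nullary
open import Relation.Nullary.Decidable using (_×-dec_; _⊎-dec_; ¬?; decidable-stable; dec-true)
open import Defs

open ℝ≥0
open Positive
open Sum +-0-commutativeMonoid
module ∑ℚ = Sum ℚ.+-0-commutativeMonoid

private variable
  n m k l q t₁ t₂ : ℕ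
  A B D : Set

-- Indicator sums

𝟙 : Dec A → ℕ
𝟙 a? = if does a? then 1 else 0

𝟙≤1 : (a? : Dec A) → 𝟙 a? ≤ 1
𝟙≤1 (yes _) = ≤-refl
𝟙≤1 (no _)  = z≤n

𝟙-yes : (a? : Dec A) → A → 𝟙 a? ≡ 1
𝟙-yes (yes _) _ = refl
𝟙-yes (no ¬a) a = contradiction a ¬a

𝟙-no : (a? : Dec A) → ¬ A → 𝟙 a? ≡ 0
𝟙-no (yes a) ¬a = contradiction a ¬a
𝟙-no (no _)  _  = refl

𝟙-bound : (a? : Dec A) {k : ℕ} → (A → 1 ≤ k) → 𝟙 a? ≤ k
𝟙-bound (yes a) f = f a
𝟙-bound (no _)  _ = z≤n

*-𝟙-bound : ∀ k (a? : Dec A) {l} → (A → k ≤ l) → k * 𝟙 a? ≤ l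
*-𝟙-bound k (yes a) f = ≤-trans (≤-reflexive (*-identityʳ k)) (f a)
*-𝟙-bound k (no _)  _ = ≤-trans (≤-reflexive (*-zeroʳ k)) z≤n

𝟙-mono : (a? : Dec A) (b? : Dec B) → (A → B) → 𝟙 a? ≤ 𝟙 b?
𝟙-mono a? b? f = 𝟙-bound a? (λ a → ≤-reflexive (sym (𝟙-yes b? (f a))))

𝟙-union : (a? : Dec A) (b? : Dec B) (c? : Dec D) → (A → B ⊎ D) → 𝟙 a? ≤ 𝟙 b? + 𝟙 c?
𝟙-union a? b? c? f = 𝟙-bound a? (λ a → case′ (f a))
  where
  case′ : _ → 1 ≤ 𝟙 b? + 𝟙 c?
  case′ (inj₁ b) = ≤-trans (≤-reflexive (sym (𝟙-yes b? b))) (m≤m+n _ _)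
  case′ (inj₂ c) = ≤-trans (≤-reflexive (sym (𝟙-yes c? c))) (m≤n+m _ _)

sum-mono : {f g : Fin n → ℕ} → (∀ i → f i ≤ g i) → sum f ≤ sum g
sum-mono {zero}  f≤g = z≤n
sum-mono {suc n} f≤g = +-mono-≤ (f≤g Fin.zero) (sum-mono (f≤g ∘ Fin.suc))

sum-mono-< : {f g : Fin n → ℕ} → (∀ i → f i ≤ g i) → ∀ i → f i < g i → sum f < sum g
sum-mono-< f≤g Fin.zero    f<g = +-mono-<-≤ f<g (sum-mono (f≤g ∘ Fin.suc))
sum-mono-< f≤g (Fin.suc i) f<g = +-mono-≤-< (f≤g Fin.zero) (sum-mono-< (f≤g ∘ Fin.suc) i f<g)

sum-const : ∀ n c → sum {n} (λ _ → c) ≡ n * c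
sum-const zero    c = refl
sum-const (suc n) c = cong (c +_) (sum-const n c)

sum-*ˡ : ∀ c (f : Fin n → ℕ) → sum (λ i → c * f i) ≡ c * sum f
sum-*ˡ {zero}  c f = sym (*-zeroʳ c)
sum-*ˡ {suc n} c f = trans (cong (c * f Fin.zero +_) (sum-*ˡ c (f ∘ Fin.suc)))
                           (sym (*-distribˡ-+ c (f Fin.zero) _))

sum-bound : (f : Fin n → ℕ) (c : ℕ) → (∀ i → f i ≤ c) → sum f ≤ n * c
sum-bound {n} f c f≤c = subst (sum f ≤_) (sum-const n c) (sum-mono f≤c)

sum-≥ : (f : Fin n → ℕ) (i : Fin n) → f i ≤ sum f
sum-≥ f Fin.zero    = m≤m+n _ _
sum-≥ f (Fin.suc i) = ≤-trans (sum-≥ (f ∘ Fin.suc) i) (m≤n+m _ _)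

sum-all-0 : (f : Fin n → ℕ) → (∀ i → f i ≡ 0) → sum f ≡ 0
sum-all-0 {n} f f≡0 = trans (sum-cong-≗ f≡0) (trans (sum-const n 0) (*-zeroʳ n))

count : {A : Fin n → Set} → (∀ i → Dec (A i)) → ℕ
count A? = sum (λ i → 𝟙 (A? i))

count-exclusive : {A : Fin n → Set} (A? : ∀ i → Dec (A i)) →
                  (∀ {i j} → A i → A j → i ≡ j) → count A? ≤ 1
count-exclusive {zero}  A? unique = z≤n
count-exclusive {suc n} A? unique with A? Fin.zero
... | yes a = ≤-reflexive (cong suc (sum-all-0 _ (λ i → 𝟙-no (A? (Fin.suc i)) (λ a′ → Fin.0≢1+n (unique a a′)))))
... | no _  = count-exclusive (A? ∘ Fin.suc) (λ a a′ → Fin.suc-injective (unique a a′))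

-- Exchange of summation: `f i` equals exactly one `c`, so every index is counted in exactly one
-- fibre.
count-fibres : {A : Fin n → Set} (A? : ∀ i → Dec (A i)) (f : Fin n → Fin m) →
               count A? ≡ sum {m} (λ c → count (λ i → A? i ×-dec (f i Fin.≟ c)))
count-fibres {n} {m} A? f = trans (sum-cong-≗ fibre) (∑-comm (λ i c → 𝟙 (A? i ×-dec (f i Fin.≟ c))))
  where
  point : ∀ {k} (d : Fin k) → count (λ c → d Fin.≟ c) ≡ 1
  point d = ≤-antisym (count-exclusive (λ c → d Fin.≟ c) (λ p q → trans (sym p) q))
    (≤-trans (≤-reflexive (sym (𝟙-yes (d Fin.≟ d) refl))) (sum-≥ (λ c → 𝟙 (d Fin.≟ c)) d))
  fibre : ∀ i → 𝟙 (A? i) ≡ sum (λ c → 𝟙 (A? i ×-dec (f i Fin.≟ c)))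
  fibre i with A? i
  ... | no _  = sym (sum-all-0 {m} (λ _ → 0) (λ _ → refl))
  ... | yes _ = sym (point (f i))

count-injection : {A : Fin n → Set} (A? : ∀ i → Dec (A i)) (f : Fin n → Fin m) →
                  (∀ {i j} → A i → A j → f i ≡ f j → i ≡ j) → count A? ≤ m
count-injection {n} {m} A? f inj = begin
  count A?                                              ≡⟨ count-fibres A? f ⟩
  sum (λ c → count (λ i → A? i ×-dec (f i Fin.≟ c)))    ≤⟨ sum-bound {m} _ 1 (λ c → count-exclusive
      (λ i → A? i ×-dec (f i Fin.≟ c)) (λ {(a , p) (a′ , p′) → inj a a′ (trans p (sym p′))})) ⟩
  m * 1                                                 ≡⟨ *-identityʳ m ⟩
  m                                                     ∎
  where open ≤-Reasoning

count-mono : {A B : Fin n → Set} (A? : ∀ i → Dec (A i)) (B? : ∀ i → Dec (B i)) →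
             (∀ i → A i → B i) → count A? ≤ count B?
count-mono A? B? f = sum-mono (λ i → 𝟙-mono (A? i) (B? i) (f i))

count-interval-≤ : ∀ {A : Fin n → Set} (A? : ∀ i → Dec (A i)) lo len →
                   (∀ i → A i → lo ≤ toℕ i × toℕ i < lo + len) → count A? ≤ len
count-interval-≤ {n} A? lo len A⊆ = go len A? A⊆
  where
  go : ∀ l {A : Fin n → Set} (A? : ∀ i → Dec (A i)) →
       (∀ i → A i → lo ≤ toℕ i × toℕ i < lo + l) → count A? ≤ l
  go zero A? A⊆ = ≤-reflexive (sum-all-0 _ (λ i → 𝟙-no (A? i) (λ a →
    <-irrefl refl (≤-<-trans (A⊆ i a .proj₁) (subst (toℕ i <_) (+-identityʳ lo) (A⊆ i a .proj₂))))))
  go (suc l) A? A⊆ = begin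
    count A?                              ≤⟨ sum-mono (λ i → 𝟙-union (A? i) (low? i) (top? i) (split i)) ⟩
    sum (λ i → 𝟙 (low? i) + 𝟙 (top? i))   ≡⟨ ∑-distrib-+ (𝟙 ∘ low?) (𝟙 ∘ top?) ⟩
    count low? + count top?               ≤⟨ +-mono-≤ (go l low? (λ i (a , i<) → A⊆ i a .proj₁ , i<))
                                               (count-exclusive top? (λ p p′ → Fin.toℕ-injective (trans p (sym p′)))) ⟩
    l + 1                                 ≡⟨ +-comm l 1 ⟩
    suc l                                 ∎
    where
    open ≤-Reasoning
    low? = λ i → A? i ×-dec (toℕ i <? lo + l)
    top? = λ i → toℕ i ≟ lo + l
    split : ∀ i → _ → _
    split i a with toℕ i <? lo + l
    ... | yes i< = inj₁ (a , i<)
    ... | no  i≮ = inj₂ (≤-antisym (s≤s⁻¹ (subst (toℕ i <_) (+-suc lo l) (A⊆ i a .proj₂))) (≮⇒≥ i≮))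

count-interval-≥ : ∀ {A : Fin n → Set} (A? : ∀ i → Dec (A i)) lo len → lo + len ≤ n →
                   (∀ i → lo ≤ toℕ i → toℕ i < lo + len → A i) → len ≤ count A?
count-interval-≥ {n} A? zero zero _ _ = z≤n
count-interval-≥ {suc n} A? zero (suc len) (s≤s hi≤n) ⊆A =
  +-mono-≤ (≤-reflexive (sym (𝟙-yes (A? Fin.zero) (⊆A Fin.zero z≤n z<s))))
           (count-interval-≥ (A? ∘ Fin.suc) zero len hi≤n (λ i _ i< → ⊆A (Fin.suc i) z≤n (s≤s i<)))
count-interval-≥ {suc n} A? (suc lo) len (s≤s hi≤n) ⊆A =
  ≤-trans (count-interval-≥ (A? ∘ Fin.suc) lo len hi≤n (λ i lo≤ i< → ⊆A (Fin.suc i) (s≤s lo≤) (s≤s i<)))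
          (m≤n+m _ (𝟙 (A? Fin.zero)))

count-all : {A : Fin n → Set} (A? : ∀ i → Dec (A i)) → (∀ i → A i) → count A? ≡ n
count-all {n} A? all = trans (sum-cong-≗ (λ i → 𝟙-yes (A? i) (all i))) (trans (sum-const n 1) (*-identityʳ n))

count-< : {A : Fin n → Set} (A? : ∀ i → Dec (A i)) → count A? < n → ∃[ i ] ¬ A i
count-< {n} A? c<n with Fin.any? (λ i → ¬? (A? i))
... | yes w = w
... | no ∄  = contradiction c<n (<-irrefl (count-all A? (λ i → decidable-stable (A? i) (λ ¬a → ∄ (i , ¬a)))))

-- Bubble sort and the planar tau distance

≈-flip : {π ρ : Permutation′ n} → π ≈ ρ → flip π ≈ flip ρ
≈-flip {π = π} {ρ} π≈ρ i = begin
  π ⟨$⟩ˡ i                     ≡⟨ cong (π ⟨$⟩ˡ_) (inverseʳ ρ) ⟨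
  π ⟨$⟩ˡ (ρ ⟨$⟩ʳ (ρ ⟨$⟩ˡ i))   ≡⟨ cong (π ⟨$⟩ˡ_) (π≈ρ (ρ ⟨$⟩ˡ i)) ⟨
  π ⟨$⟩ˡ (π ⟨$⟩ʳ (ρ ⟨$⟩ˡ i))   ≡⟨ inverseˡ π ⟩
  ρ ⟨$⟩ˡ i                     ∎
  where open ≡-Reasoning

AdjacentSwap-resp : {f f′ g : Fin n → Fin n} → (∀ i → f i ≡ f′ i) → AdjacentSwap f g → AdjacentSwap f′ g
AdjacentSwap-resp f≗ (i , i⁺ , i⁺≡ , gi , gi⁺ , g-rest) =
  i , i⁺ , i⁺≡ , trans gi (f≗ i⁺) , trans gi⁺ (f≗ i) , λ l l≢i l≢i⁺ → trans (g-rest l l≢i l≢i⁺) (f≗ l)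

-- Permutations carry their inverses and proofs as data and are compared pointwise, so endpoints of
-- paths are replaced along `≈`.
Path-respˡ : {π π′ σ : Permutation′ n} → π ≈ π′ → Path t₁ π σ → Path t₁ π′ σ
Path-respˡ π≈π′ (done π≈σ) = done (λ i → trans (sym (π≈π′ i)) (π≈σ i))
Path-respˡ {π = π} {π′} π≈π′ (step s p) =
  step (Sum⊎.map (AdjacentSwap-resp π≈π′) (AdjacentSwap-resp (≈-flip {π = π} {π′} π≈π′)) s) p

Path-respʳ : {π σ σ′ : Permutation′ n} → σ ≈ σ′ → Path t₁ π σ → Path t₁ π σ′
Path-respʳ σ≈σ′ (done π≈σ) = done (λ i → trans (π≈σ i) (σ≈σ′ i))
Path-respʳ σ≈σ′ (step s p) = step s (Path-respʳ σ≈σ′ p)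

Path-trans : {π σ τ : Permutation′ n} → Path t₁ π σ → Path t₂ σ τ → Path (t₁ + t₂) π τ
Path-trans {π = π} {σ} (done π≈σ) q = Path-respˡ {π = σ} {π} (λ i → sym (π≈σ i)) q
Path-trans (step s p) q = step s (Path-trans p q)

-- Inversion interchanges the two kinds of planar simple transposition, so results on sorting
-- positions carry over to values.
Path-flip : {π σ : Permutation′ n} → Path t₁ π σ → Path t₁ (flip π) (flip σ)
Path-flip {π = π} {σ} (done π≈σ) = done (≈-flip {π = π} {σ} π≈σ)
Path-flip (step s p) = step (Sum⊎.swap s) (Path-flip p)

inversions : Permutation′ n → ℕ
inversions φ = sum (λ a → count (λ b → (a Fin.<? b) ×-dec (φ ⟨$⟩ʳ b Fin.<? φ ⟨$⟩ʳ a)))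

Descent : Permutation′ n → Set
Descent φ = ∃[ i ] ∃[ i⁺ ] toℕ i⁺ ≡ suc (toℕ i) × φ ⟨$⟩ʳ i⁺ Fin.< φ ⟨$⟩ʳ i

descent? : (φ : Permutation′ n) → Dec (Descent φ)
descent? φ = Fin.any? λ i → Fin.any? λ i⁺ → (toℕ i⁺ ≟ suc (toℕ i)) ×-dec (φ ⟨$⟩ʳ i⁺ Fin.<? φ ⟨$⟩ʳ i)

permutation-injective : (φ : Permutation′ n) {a b : Fin n} → φ ⟨$⟩ʳ a ≡ φ ⟨$⟩ʳ b → a ≡ b
permutation-injective φ {a} {b} e = trans (sym (inverseˡ φ)) (trans (cong (φ ⟨$⟩ˡ_) e) (inverseˡ φ))

≤∧≢⇒<ᶠ : {a b : Fin n} → toℕ a ≤ toℕ b → a ≢ b → a Fin.< b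
≤∧≢⇒<ᶠ a≤b a≢b = ≤∧≢⇒< a≤b (a≢b ∘ Fin.toℕ-injective)

¬descent⇒monotone : (φ : Permutation′ n) → ¬ Descent φ → ∀ {a b} → a Fin.< b → φ ⟨$⟩ʳ a Fin.< φ ⟨$⟩ʳ b
¬descent⇒monotone {n} φ ¬desc {a} {b} a<b = go (toℕ b ∸ suc (toℕ a)) a b (sym (m∸n+n≡m a<b))
  where
  -- Induction on the gap `d + 1` between `a` and `b`; gap 1 is the absence of descents, since `φ`
  -- is injective.
  go : ∀ d a b → toℕ b ≡ d + suc (toℕ a) → φ ⟨$⟩ʳ a Fin.< φ ⟨$⟩ʳ b
  go zero a b b≡ = ≤∧≢⇒<ᶠ (≮⇒≥ (λ φb<φa → ¬desc (a , b , b≡ , φb<φa)))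
    (λ e → 1+n≢n (trans (sym b≡) (cong toℕ (permutation-injective φ (sym e)))))
  go (suc d) a b b≡ = <-trans (go d a b⁻ b⁻≡) (go zero b⁻ b (trans b≡ (cong suc (sym b⁻≡))))
    where
    b⁻< : d + suc (toℕ a) < n
    b⁻< = ≤-trans (≤-reflexive (sym b≡)) (<⇒≤ (Fin.toℕ<n b))
    b⁻ = fromℕ< b⁻<
    b⁻≡ = Fin.toℕ-fromℕ< b⁻<

monotone⇒inflationary : (f : Fin n → Fin n) → (∀ {a b} → a Fin.< b → f a Fin.< f b) → ∀ i → i Fin.≤ f i
monotone⇒inflationary {n} f mono i = go (toℕ i) i refl
  where
  go : ∀ k i → toℕ i ≡ k → k ≤ toℕ (f i)
  go zero i _ = z≤n
  go (suc k) i i≡ = ≤-<-trans (go k i⁻ i⁻≡) (mono (subst₂ _<_ (sym i⁻≡) (sym i≡) ≤-refl))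
    where
    i⁻< : k < n
    i⁻< = ≤-trans (≤-reflexive (sym i≡)) (<⇒≤ (Fin.toℕ<n i))
    i⁻ = fromℕ< i⁻<
    i⁻≡ = Fin.toℕ-fromℕ< i⁻<

-- Neither `φ` nor its inverse, which is monotone too, moves an index down. The inverse takes `φ i`
-- to `i`, so `φ i` is at most `i` as well.
monotone⇒identity : (φ : Permutation′ n) → (∀ {a b} → a Fin.< b → φ ⟨$⟩ʳ a Fin.< φ ⟨$⟩ʳ b) → ∀ i → φ ⟨$⟩ʳ i ≡ i
monotone⇒identity φ mono i = Fin.toℕ-injective (≤-antisym
  (subst (λ j → toℕ (φ ⟨$⟩ʳ i) ≤ toℕ j) (inverseˡ φ) (monotone⇒inflationary (φ ⟨$⟩ˡ_) mono⁻¹ (φ ⟨$⟩ʳ i)))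
  (monotone⇒inflationary (φ ⟨$⟩ʳ_) mono i))
  where
  mono⁻¹ : ∀ {a b} → a Fin.< b → φ ⟨$⟩ˡ a Fin.< φ ⟨$⟩ˡ b
  mono⁻¹ {a} {b} a<b with φ ⟨$⟩ˡ a Fin.<? φ ⟨$⟩ˡ b
  ... | yes <b = <b
  ... | no ≮b with φ ⟨$⟩ˡ a Fin.≟ φ ⟨$⟩ˡ b
  ...   | yes e = contradiction a<b (<-irrefl (cong toℕ (permutation-injective (flip φ) e)))
  ...   | no ≢b = contradiction a<b (<-asym (subst₂ Fin._<_ (inverseʳ φ) (inverseʳ φ)
                    (mono (≤∧≢⇒<ᶠ (≮⇒≥ ≮b) (≢b ∘ sym)))))

module _ {i i⁺ : Fin n} (i⁺≡ : toℕ i⁺ ≡ suc (toℕ i)) where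

  private
    s = transpose i i⁺

  data Swapped (k : Fin n) : Fin n → Set where
    at-i  : k ≡ i  → Swapped k i⁺
    at-i⁺ : k ≡ i⁺ → Swapped k i
    away  : k ≢ i → k ≢ i⁺ → Swapped k k

  swapped : ∀ k → Swapped k (s ⟨$⟩ʳ k)
  swapped k with k Fin.≟ i
  ... | yes k≡i = at-i k≡i
  ... | no  k≢i with k Fin.≟ i⁺
  ...   | yes k≡i⁺ = at-i⁺ k≡i⁺
  ...   | no  k≢i⁺ = away k≢i k≢i⁺

  private
    i≢i⁺ : i ≢ i⁺
    i≢i⁺ e = 1+n≢n (trans (sym i⁺≡) (cong toℕ (sym e)))

    s-i : s ⟨$⟩ʳ i ≡ i⁺
    s-i with s ⟨$⟩ʳ i | swapped i
    ... | _ | at-i _     = refl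
    ... | _ | at-i⁺ e    = contradiction e i≢i⁺
    ... | _ | away i≢i _ = contradiction refl i≢i

    s-i⁺ : s ⟨$⟩ʳ i⁺ ≡ i
    s-i⁺ with s ⟨$⟩ʳ i⁺ | swapped i⁺
    ... | _ | at-i e       = contradiction (sym e) i≢i⁺
    ... | _ | at-i⁺ _      = refl
    ... | _ | away _ i⁺≢i⁺ = contradiction refl i⁺≢i⁺

    s-away : ∀ {l} → l ≢ i → l ≢ i⁺ → s ⟨$⟩ʳ l ≡ l
    s-away {l} l≢i l≢i⁺ with s ⟨$⟩ʳ l | swapped l
    ... | _ | at-i e   = contradiction e l≢i
    ... | _ | at-i⁺ e  = contradiction e l≢i⁺
    ... | _ | away _ _ = refl

  swap-adjacent : (π : Permutation′ n) → PlanarSimpleTransposition π (s ∘ₚ π)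
  swap-adjacent π = inj₁ (i , i⁺ , i⁺≡ , cong (π ⟨$⟩ʳ_) (s-i)
    , cong (π ⟨$⟩ʳ_) (s-i⁺) , λ l l≢i l≢i⁺ → cong (π ⟨$⟩ʳ_) (s-away l≢i l≢i⁺))

  -- No index lies strictly between `i` and `i⁺`, so exchanging them changes the comparison of no
  -- other pair.
  swap-order : ∀ a b → s ⟨$⟩ʳ a Fin.< s ⟨$⟩ʳ b → a Fin.< b ⊎ (a ≡ i⁺ × b ≡ i)
  swap-order a b lt with s ⟨$⟩ʳ a | swapped a | s ⟨$⟩ʳ b | swapped b
  ... | _ | at-i refl    | _ | at-i refl   = contradiction lt (<-irrefl refl)
  ... | _ | at-i refl    | _ | at-i⁺ refl  = inj₁ (≤-reflexive (sym i⁺≡))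
  ... | _ | at-i refl    | _ | away _ _    = inj₁ (<-trans (≤-reflexive (sym i⁺≡)) lt)
  ... | _ | at-i⁺ refl   | _ | at-i refl   = inj₂ (refl , refl)
  ... | _ | at-i⁺ refl   | _ | at-i⁺ refl  = contradiction lt (<-irrefl refl)
  ... | _ | at-i⁺ refl   | _ | away _ b≢i⁺ = inj₁ (≤∧≢⇒<ᶠ (subst (_≤ toℕ b) (sym i⁺≡) lt) (b≢i⁺ ∘ sym))
  ... | _ | away a≢i _   | _ | at-i refl   = inj₁ (≤∧≢⇒<ᶠ (s≤s⁻¹ (subst (toℕ a <_) i⁺≡ lt)) a≢i)
  ... | _ | away _ _     | _ | at-i⁺ refl  = inj₁ (<-trans lt (≤-reflexive (sym i⁺≡)))
  ... | _ | away _ _     | _ | away _ _    = inj₁ lt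

  -- After both sums are reindexed by the involution `s`, every inversion of `s ∘ₚ φ` becomes one of
  -- `φ`: the only reversed pair would contradict the descent. The descent `(i , i⁺)` itself is
  -- lost.
  swap-inversions : (φ : Permutation′ n) → φ ⟨$⟩ʳ i⁺ Fin.< φ ⟨$⟩ʳ i → inversions (s ∘ₚ φ) < inversions φ
  swap-inversions φ desc = begin-strict
    inversions (s ∘ₚ φ)                      ≡⟨ sum-permute (λ a → count (inv′? a)) s ⟩
    sum (λ a → count (inv′? (s ⟨$⟩ʳ a)))     ≡⟨ sum-cong-≗ (λ a → sum-permute (λ b → 𝟙 (inv′? (s ⟨$⟩ʳ a) b)) s) ⟩
    sum (λ a → count (λ b → inv′? (s ⟨$⟩ʳ a) (s ⟨$⟩ʳ b)))
                                             <⟨ sum-mono-< (λ a → sum-mono (pointwise a)) i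
                                                  (sum-mono-< (pointwise i) i⁺ fewer) ⟩
    inversions φ                             ∎
    where
    open ≤-Reasoning
    inv? : ∀ a b → Dec (a Fin.< b × φ ⟨$⟩ʳ b Fin.< φ ⟨$⟩ʳ a)
    inv? a b = (a Fin.<? b) ×-dec (φ ⟨$⟩ʳ b Fin.<? φ ⟨$⟩ʳ a)
    inv′? : ∀ a b → Dec (a Fin.< b × φ ⟨$⟩ʳ (s ⟨$⟩ʳ b) Fin.< φ ⟨$⟩ʳ (s ⟨$⟩ʳ a))
    inv′? a b = (a Fin.<? b) ×-dec (φ ⟨$⟩ʳ (s ⟨$⟩ʳ b) Fin.<? φ ⟨$⟩ʳ (s ⟨$⟩ʳ a))
    involutive : ∀ a → s ⟨$⟩ʳ (s ⟨$⟩ʳ a) ≡ a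
    involutive a with s ⟨$⟩ʳ a | swapped a
    ... | _ | at-i refl  = s-i⁺
    ... | _ | at-i⁺ refl = s-i
    ... | _ | away a≢i a≢i⁺ = s-away a≢i a≢i⁺
    pointwise : ∀ a b → 𝟙 (inv′? (s ⟨$⟩ʳ a) (s ⟨$⟩ʳ b)) ≤ 𝟙 (inv? a b)
    pointwise a b = 𝟙-mono (inv′? (s ⟨$⟩ʳ a) (s ⟨$⟩ʳ b)) (inv? a b) λ (sa<sb , φ<) →
      let φb<φa = subst₂ (λ c d → φ ⟨$⟩ʳ c Fin.< φ ⟨$⟩ʳ d) (involutive b) (involutive a) φ< in
      (Sum⊎.[ (λ a<b → a<b) , (λ { (refl , refl) → contradiction desc (<-asym φb<φa) }) ] (swap-order a b sa<sb))
      , φb<φa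
    fewer : 𝟙 (inv′? (s ⟨$⟩ʳ i) (s ⟨$⟩ʳ i⁺)) < 𝟙 (inv? i i⁺)
    fewer = subst₂ _<_ (sym (𝟙-no (inv′? (s ⟨$⟩ʳ i) (s ⟨$⟩ʳ i⁺)) λ (si<si⁺ , _) →
        <-asym (≤-reflexive (sym i⁺≡))
          (subst₂ Fin._<_ (s-i) (s-i⁺) si<si⁺)))
      (sym (𝟙-yes (inv? i i⁺) (≤-reflexive (sym i⁺≡) , desc))) z<s

-- Point `i` travels to position `φ i`. A swap at a descent of `φ` is applied to `π` and `φ` alike,
-- so the target stays the same while the inversions drop; without a descent `φ` is the identity.
bubbleSort : (π φ : Permutation′ n) → ∃[ t ] t ≤ inversions φ × Path t π (flip φ ∘ₚ π)
bubbleSort {n} π φ = go (inversions φ) π φ ≤-refl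
  where
  go : ∀ fuel (π φ : Permutation′ n) → inversions φ ≤ fuel →
       ∃[ t ] t ≤ inversions φ × Path t π (flip φ ∘ₚ π)
  go fuel π φ inv≤ with descent? φ
  ... | no ¬desc = 0 , z≤n , done λ i → cong (π ⟨$⟩ʳ_)
          (trans (sym (inverseˡ φ)) (cong (φ ⟨$⟩ˡ_) (monotone⇒identity φ (¬descent⇒monotone φ ¬desc) i)))
  go zero π φ inv≤ | yes (i , i⁺ , i⁺≡ , desc) = contradiction (<-≤-trans (swap-inversions i⁺≡ φ desc) inv≤) λ ()
  go (suc fuel) π φ inv≤ | yes (i , i⁺ , i⁺≡ , desc) =
    let s = transpose i i⁺
        fewer = swap-inversions i⁺≡ φ desc
        t , t≤ , path = go fuel (s ∘ₚ π) (s ∘ₚ φ) (s≤s⁻¹ (<-≤-trans fewer inv≤))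
    in suc t , ≤-<-trans t≤ fewer , step {τ = s ∘ₚ π} (swap-adjacent i⁺≡ π)
         (Path-respʳ {σ = flip (s ∘ₚ φ) ∘ₚ (s ∘ₚ π)} {flip φ ∘ₚ π} (λ k → cong (π ⟨$⟩ʳ_) (inverseʳ s)) path)

-- The target has point `i` of `π` in column `φ i` and row `ψ i`. Sorting the columns leads to
-- `flip φ ∘ₚ π`. Its inverse `flip π ∘ₚ φ` has the values of `π` as positions, and `χ` says to
-- which row each value must move.
sortBoth : (π φ ψ : Permutation′ n) →
           ∃[ t ] t ≤ inversions φ + inversions (flip π ∘ₚ ψ) × Path t π (flip φ ∘ₚ ψ)
sortBoth π φ ψ =
  let t , t≤ , p = bubbleSort π φ
      χ = flip π ∘ₚ ψ
      u , u≤ , q = bubbleSort (flip π ∘ₚ φ) χ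
  in t + u , +-mono-≤ t≤ u≤ , Path-trans p
       (Path-respˡ {π = flip (flip π ∘ₚ φ)} {flip φ ∘ₚ π} (λ _ → refl)
       (Path-respʳ {σ = flip (flip χ ∘ₚ (flip π ∘ₚ φ))} {flip φ ∘ₚ ψ} (λ _ → cong (ψ ⟨$⟩ʳ_) (inverseˡ π))
       (Path-flip q)))

-- Inversion counts and displacement

2*nC2 : ∀ n → 2 * (n C 2) ≡ n * (n ∸ 1)
2*nC2 zero = refl
2*nC2 (suc zero) = refl
2*nC2 (suc (suc m)) = begin
  2 * (suc (suc m) C 2)               ≡⟨ cong (2 *_) (nCk+nC[k+1]≡[n+1]C[k+1] (suc m) 1) ⟨
  2 * (suc m C 1 + suc m C 2)         ≡⟨ cong (λ x → 2 * (x + suc m C 2)) (nC1≡n (suc m)) ⟩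
  2 * (suc m + suc m C 2)             ≡⟨ *-distribˡ-+ 2 (suc m) _ ⟩
  2 * suc m + 2 * (suc m C 2)         ≡⟨ cong (2 * suc m +_) (2*nC2 (suc m)) ⟩
  2 * suc m + suc m * m               ≡⟨ identity m ⟩
  suc (suc m) * suc m                 ∎
  where
  open ≡-Reasoning
  identity : ∀ m → 2 * suc m + suc m * m ≡ suc (suc m) * suc m
  identity = solve-∀

count-pairs : ∀ n → sum {n} (λ a → count {n} (λ b → a Fin.<? b)) ≤ n C 2
count-pairs zero = z≤n
count-pairs (suc m) = begin
  count {m} (λ b → Fin.zero {m} Fin.<? Fin.suc b) + sum {m} (λ a → count {m} (λ b → Fin.suc a Fin.<? Fin.suc b))
     ≤⟨ +-mono-≤ (sum-bound {m} _ 1 (λ b → 𝟙≤1 (Fin.zero {m} Fin.<? Fin.suc b)))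
          (sum-mono {m} (λ a → count-mono {m} (λ b → Fin.suc a Fin.<? Fin.suc b) (λ b → a Fin.<? b) (λ _ → s≤s⁻¹))) ⟩
  m * 1 + sum {m} (λ a → count {m} (λ b → a Fin.<? b))
     ≤⟨ +-mono-≤ (≤-reflexive (trans (*-identityʳ m) (sym (nC1≡n m)))) (count-pairs m) ⟩
  m C 1 + m C 2   ≡⟨ nCk+nC[k+1]≡[n+1]C[k+1] m 1 ⟩
  suc m C 2       ∎
  where open ≤-Reasoning

inversions≤nC2 : (φ : Permutation′ n) → inversions φ ≤ n C 2
inversions≤nC2 {n} φ = ≤-trans (sum-mono {n} {g = λ a → count {n} (λ b → a Fin.<? b)} (λ a → count-mono {n}
  (λ b → (a Fin.<? b) ×-dec (φ ⟨$⟩ʳ b Fin.<? φ ⟨$⟩ʳ a)) (λ b → a Fin.<? b) (λ _ → proj₁))) (count-pairs n)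

-- An inversion a < b forces key b ≤ key a, so a or b lies at distance at least
-- (b - a) / 2 from its key.
inversions≤displacement : (φ : Permutation′ n) (key : Fin n → ℕ) →
  (∀ {a b} → key a < key b → φ ⟨$⟩ʳ a Fin.< φ ⟨$⟩ʳ b) →
  inversions φ ≤ 4 * sum (λ a → ∣ toℕ a - key a ∣)
inversions≤displacement {n} φ key mono = begin
  inversions φ
    ≤⟨ sum-mono {n} (λ a → sum-mono {n} (λ b → 𝟙-union (inv? a b) (right? a b) (left? a b) (charge a b))) ⟩
  sum (λ a → sum (λ b → 𝟙 (right? a b) + 𝟙 (left? a b)))
    ≡⟨ sum-cong-≗ {n} (λ a → ∑-distrib-+ (λ b → 𝟙 (right? a b)) (λ b → 𝟙 (left? a b))) ⟩
  sum (λ a → count (right? a) + count (left? a))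
    ≡⟨ ∑-distrib-+ (λ a → count (right? a)) (λ a → count (left? a)) ⟩
  sum (λ a → count (right? a)) + sum (λ a → count (left? a))
    ≡⟨ cong (sum (λ a → count (right? a)) +_) (∑-comm (λ a b → 𝟙 (left? a b))) ⟩
  sum (λ a → count (right? a)) + sum (λ b → count (λ a → left? a b))
    ≤⟨ +-mono-≤ (sum-mono {n} (λ a → count-interval-≤ (right? a) (suc (toℕ a)) (2 * d a) (λ b (a<b , b≤) → a<b , s≤s b≤)))
                -- If `2 * d b` exceeds `b`, the truncated interval starts at 0 and still contains
                -- all `a` below `b`.
                (sum-mono {n} (λ b → count-interval-≤ (λ a → left? a b) (toℕ b ∸ 2 * d b) (2 * d b) (λ a → left⊆ a b))) ⟩
  sum (λ a → 2 * d a) + sum (λ a → 2 * d a)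
    ≡⟨ cong (λ x → x + x) (sum-*ˡ {n} 2 d) ⟩
  2 * sum d + 2 * sum d
    ≡⟨ *-distribʳ-+ (sum d) 2 2 ⟨
  4 * sum d ∎
  where
  open ≤-Reasoning
  d : Fin n → ℕ
  d a = ∣ toℕ a - key a ∣
  inv?   = λ a b → (a Fin.<? b) ×-dec (φ ⟨$⟩ʳ b Fin.<? φ ⟨$⟩ʳ a)
  right? = λ a b → (a Fin.<? b) ×-dec (toℕ b ≤? toℕ a + 2 * d a)
  left?  = λ a b → (a Fin.<? b) ×-dec (toℕ b ≤? toℕ a + 2 * d b)
  left⊆ : ∀ a b → a Fin.< b × toℕ b ≤ toℕ a + 2 * d b →
          toℕ b ∸ 2 * d b ≤ toℕ a × toℕ a < toℕ b ∸ 2 * d b + 2 * d b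
  left⊆ a b (a<b , b≤) = m≤n+o⇒m∸n≤o (toℕ b) (2 * d b) (subst (toℕ b ≤_) (+-comm (toℕ a) _) b≤)
    , <-≤-trans a<b (subst (toℕ b ≤_) (+-comm (2 * d b) _) (m≤n+m∸n (toℕ b) (2 * d b)))
  close : ∀ a b → ¬ key a < key b → toℕ b ≤ toℕ a + (d a + d b)
  close a b ka≮kb = begin
    toℕ b               ≤⟨ m≤n+∣m-n∣ (toℕ b) (key b) ⟩
    key b + d b         ≤⟨ +-monoˡ-≤ (d b) (≮⇒≥ ka≮kb) ⟩
    key a + d b         ≤⟨ +-monoˡ-≤ (d b) (m≤n+∣n-m∣ (key a) (toℕ a)) ⟩
    toℕ a + d a + d b   ≡⟨ +-assoc (toℕ a) (d a) (d b) ⟩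
    toℕ a + (d a + d b) ∎
  double : ∀ x → x + x ≡ 2 * x
  double = solve-∀
  charge : ∀ a b → a Fin.< b × φ ⟨$⟩ʳ b Fin.< φ ⟨$⟩ʳ a →
           (a Fin.< b × toℕ b ≤ toℕ a + 2 * d a) ⊎ (a Fin.< b × toℕ b ≤ toℕ a + 2 * d b)
  charge a b (a<b , φb<φa) with close a b (λ ka<kb → <-asym (mono ka<kb) φb<φa) | ≤-total (d a) (d b)
  ... | b≤ | inj₁ da≤db = inj₂ (a<b , ≤-trans b≤ (+-monoʳ-≤ (toℕ a)
          (subst (d a + d b ≤_) (double (d b)) (+-monoˡ-≤ (d b) da≤db))))
  ... | b≤ | inj₂ db≤da = inj₁ (a<b , ≤-trans b≤ (+-monoʳ-≤ (toℕ a)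
          (subst (d a + d b ≤_) (double (d a)) (+-monoʳ-≤ (d a) db≤da))))

-- `x i` and `y i` are the column and row wanted for point `i`. Ties are allowed, because all points
-- nearest to one sample point share its coordinates as target.
sortBoth-displacement : (π φ ψ : Permutation′ n) (x y : Fin n → ℕ) →
  (∀ {i j} → x i < x j → φ ⟨$⟩ʳ i Fin.< φ ⟨$⟩ʳ j) →
  (∀ {i j} → y i < y j → ψ ⟨$⟩ʳ i Fin.< ψ ⟨$⟩ʳ j) →
  ∃[ t ] t ≤ 4 * sum (λ i → ∣ toℕ i - x i ∣ + ∣ toℕ (π ⟨$⟩ʳ i) - y i ∣) × Path t π (flip φ ∘ₚ ψ)
sortBoth-displacement {n} π φ ψ x y x-mono y-mono =
  let t , t≤ , p = sortBoth π φ ψ in t , ≤-trans t≤ bound , p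
  where
  open ≤-Reasoning
  dx = λ i → ∣ toℕ i - x i ∣
  dy = λ i → ∣ toℕ (π ⟨$⟩ʳ i) - y i ∣
  dv = λ v → ∣ toℕ v - y (π ⟨$⟩ˡ v) ∣
  bound = begin
    inversions φ + inversions (flip π ∘ₚ ψ)
      ≤⟨ +-mono-≤ (inversions≤displacement φ x x-mono)
                  (inversions≤displacement (flip π ∘ₚ ψ) (λ v → y (π ⟨$⟩ˡ v)) y-mono) ⟩
    4 * sum dx + 4 * sum dv                    ≡⟨ *-distribˡ-+ 4 (sum dx) (sum dv) ⟨
    4 * (sum dx + sum dv)                      ≡⟨ cong (λ z → 4 * (sum dx + z)) (sum-permute dv π) ⟩
    4 * (sum dx + sum (λ i → dv (π ⟨$⟩ʳ i)))   ≡⟨ cong (λ z → 4 * (sum dx + z))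
                                                 (sum-cong-≗ {n} (λ i → cong (λ j → ∣ toℕ (π ⟨$⟩ʳ i) - y j ∣) (inverseˡ π))) ⟩
    4 * (sum dx + sum dy)                      ≡⟨ cong (4 *_) (∑-distrib-+ dx dy) ⟨
    4 * sum (λ i → dx i + dy i)                ∎

-- Distance to a random sample

-- Expectations over `q` independent uniform points, with repetition, multiplied by `n ^ q` to stay
-- in the natural numbers.
∑ᵛ : ∀ q → (Vec (Fin n) q → ℕ) → ℕ
∑ᵛ zero    F = F []
∑ᵛ (suc q) F = sum (λ x → ∑ᵛ q (λ xs → F (x ∷ xs)))

∑ᵛ-mono : ∀ q {F G : Vec (Fin n) q → ℕ} → (∀ xs → F xs ≤ G xs) → ∑ᵛ q F ≤ ∑ᵛ q G
∑ᵛ-mono zero    F≤G = F≤G []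
∑ᵛ-mono (suc q) F≤G = sum-mono (λ x → ∑ᵛ-mono q (λ xs → F≤G (x ∷ xs)))

∑ᵛ-cong : ∀ q {F G : Vec (Fin n) q → ℕ} → (∀ xs → F xs ≡ G xs) → ∑ᵛ q F ≡ ∑ᵛ q G
∑ᵛ-cong zero    F≡G = F≡G []
∑ᵛ-cong (suc q) F≡G = sum-cong-≗ (λ x → ∑ᵛ-cong q (λ xs → F≡G (x ∷ xs)))

∑ᵛ-const : ∀ q c → ∑ᵛ {n} q (λ _ → c) ≡ n ^ q * c
∑ᵛ-const zero    c = sym (+-identityʳ c)
∑ᵛ-const {n} (suc q) c = begin
  sum {n} (λ _ → ∑ᵛ {n} q (λ _ → c))   ≡⟨ sum-cong-≗ {n} (λ _ → ∑ᵛ-const q c) ⟩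
  sum {n} (λ _ → n ^ q * c)            ≡⟨ sum-const n _ ⟩
  n * (n ^ q * c)                      ≡⟨ *-assoc n (n ^ q) c ⟨
  n * n ^ q * c                        ∎
  where open ≡-Reasoning

∑ᵛ-distrib-+ : ∀ q (F G : Vec (Fin n) q → ℕ) → ∑ᵛ q (λ xs → F xs + G xs) ≡ ∑ᵛ q F + ∑ᵛ q G
∑ᵛ-distrib-+ zero    F G = refl
∑ᵛ-distrib-+ {n} (suc q) F G = trans
  (sum-cong-≗ {n} (λ x → ∑ᵛ-distrib-+ q (λ xs → F (x ∷ xs)) (λ xs → G (x ∷ xs))))
  (∑-distrib-+ (λ x → ∑ᵛ q (λ xs → F (x ∷ xs))) (λ x → ∑ᵛ q (λ xs → G (x ∷ xs))))

∑ᵛ-*ˡ : ∀ q c (F : Vec (Fin n) q → ℕ) → ∑ᵛ q (λ xs → c * F xs) ≡ c * ∑ᵛ q F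
∑ᵛ-*ˡ zero    c F = refl
∑ᵛ-*ˡ {n} (suc q) c F = trans (sum-cong-≗ {n} (λ x → ∑ᵛ-*ˡ q c (λ xs → F (x ∷ xs))))
                              (sum-*ˡ {n} c _)

sum-∑ᵛ-comm : ∀ q (F : Fin m → Vec (Fin n) q → ℕ) →
              sum (λ j → ∑ᵛ q (F j)) ≡ ∑ᵛ q (λ xs → sum (λ j → F j xs))
sum-∑ᵛ-comm zero    F = refl
sum-∑ᵛ-comm {m} {n} (suc q) F = trans (∑-comm (λ j x → ∑ᵛ q (λ xs → F j (x ∷ xs))))
  (sum-cong-≗ {n} (λ x → sum-∑ᵛ-comm q (λ j xs → F j (x ∷ xs))))

-- Any coordinate can be summed outermost; this is the exchangeability that `nearest-average` rests
-- on.
∑ᵛ-insertAt : ∀ q (j : Fin (suc q)) (F : Vec (Fin n) (suc q) → ℕ) →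
              ∑ᵛ (suc q) F ≡ sum (λ x → ∑ᵛ q (λ xs → F (insertAt xs j x)))
∑ᵛ-insertAt q       Fin.zero    F = refl
∑ᵛ-insertAt {n} (suc q) (Fin.suc j) F = trans
  (sum-cong-≗ {n} (λ y → ∑ᵛ-insertAt q j (λ ys → F (y ∷ ys))))
  (∑-comm (λ y x → ∑ᵛ q (λ xs → F (y ∷ insertAt xs j x))))

same-quotient⇒close : ∀ h .{{_ : NonZero h}} a b → a / h ≡ b / h → ∣ a - b ∣ ≤ h
same-quotient⇒close h a b a/h≡b/h = begin
  ∣ a - b ∣                                      ≡⟨ cong₂ ∣_-_∣ (m≡m%n+[m/n]*n a h)
                                                     (trans (m≡m%n+[m/n]*n b h) (cong (λ k → b % h + k * h) (sym a/h≡b/h))) ⟩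
  ∣ a % h + a / h * h - b % h + a / h * h ∣      ≡⟨ cong₂ ∣_-_∣ (+-comm (a % h) _) (+-comm (b % h) _) ⟩
  ∣ a / h * h + a % h - a / h * h + b % h ∣      ≡⟨ ∣m+n-m+o∣≡∣n-o∣ (a / h * h) (a % h) (b % h) ⟩
  ∣ a % h - b % h ∣                              ≤⟨ ∣m-n∣≤m⊔n (a % h) (b % h) ⟩
  a % h ⊔ b % h                                  ≤⟨ ⊔-lub (<⇒≤ (m%n<n a h)) (<⇒≤ (m%n<n b h)) ⟩
  h                                              ∎
  where open ≤-Reasoning

module _ (π : Permutation′ n) where

  dist : Fin n → Fin n → ℕ
  dist i j = ∣ toℕ i - toℕ j ∣ + ∣ toℕ (π ⟨$⟩ʳ i) - toℕ (π ⟨$⟩ʳ j) ∣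

  dist≤2n : ∀ i j → dist i j ≤ 2 * n
  dist≤2n i j = subst (dist i j ≤_) (cong (n +_) (sym (+-identityʳ n)))
    (+-mono-≤ (gap i j) (gap (π ⟨$⟩ʳ i) (π ⟨$⟩ʳ j)))
    where
    gap : ∀ (a b : Fin n) → ∣ toℕ a - toℕ b ∣ ≤ n
    gap a b = ≤-trans (∣m-n∣≤m⊔n (toℕ a) (toℕ b)) (⊔-lub (<⇒≤ (Fin.toℕ<n a)) (<⇒≤ (Fin.toℕ<n b)))

  nearest : Fin n → Vec (Fin n) q → ℕ
  -- `2 * n` bounds every distance, so this default never changes a minimum over a nonempty sample.
  nearest i []       = 2 * n
  nearest i (x ∷ xs) = dist i x ⊓ nearest i xs

  nearest≤2n : ∀ i (xs : Vec (Fin n) q) → nearest i xs ≤ 2 * n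
  nearest≤2n i []       = ≤-refl
  nearest≤2n i (x ∷ xs) = ≤-trans (m⊓n≤n (dist i x) _) (nearest≤2n i xs)

  nearest≤dist : ∀ i (xs : Vec (Fin n) q) a → nearest i xs ≤ dist i (lookup xs a)
  nearest≤dist i (x ∷ xs) Fin.zero    = m⊓n≤m (dist i x) _
  nearest≤dist i (x ∷ xs) (Fin.suc a) = ≤-trans (m⊓n≤n (dist i x) _) (nearest≤dist i xs a)

  nearest-attained : ∀ i (xs : Vec (Fin n) (suc q)) → ∃[ a ] dist i (lookup xs a) ≤ nearest i xs
  nearest-attained i (x ∷ []) = Fin.zero , ≤-reflexive (sym (m≤n⇒m⊓n≡m (dist≤2n i x)))
  nearest-attained i (x ∷ xs@(_ ∷ _)) with ≤-total (dist i x) (nearest i xs)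
  ... | inj₁ ≤ = Fin.zero , ≤-reflexive (sym (m≤n⇒m⊓n≡m ≤))
  ... | inj₂ ≥ = let a , a≤ = nearest-attained i xs in
                 Fin.suc a , ≤-trans a≤ (≤-reflexive (sym (m≥n⇒m⊓n≡n ≥)))

  -- Removing the index rather than the point gives a point that is sampled twice the value 0.
  neighbour : Vec (Fin n) (suc q) → Fin (suc q) → ℕ
  neighbour z j = nearest (lookup z j) (removeAt z j)

  neighbour≤dist : (z : Vec (Fin n) (suc q)) {j k : Fin (suc q)} → j ≢ k →
                   neighbour z j ≤ dist (lookup z j) (lookup z k)
  neighbour≤dist z {j} {k} j≢k = subst (λ x → neighbour z j ≤ dist (lookup z j) x)
    (removeAt-punchOut z j≢k) (nearest≤dist (lookup z j) (removeAt z j) (Fin.punchOut j≢k))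

  -- Cut the square into s horizontal strips of height h.  Within a strip, the
  -- intervals [x j, x j + (neighbour z j ∸ h)) are pairwise disjoint.
  sum-neighbour : ∀ s h .{{_ : NonZero h}} → n ≤ s * h → (z : Vec (Fin n) (suc q)) →
                  sum (neighbour z) ≤ 3 * n * s + suc q * h
  sum-neighbour {q} s h n≤sh z = begin
    sum (neighbour z)
      ≤⟨ sum-mono {suc q} (λ j → m≤n+m∸n (neighbour z j) h) ⟩
    sum (λ j → h + len j)
      ≡⟨ ∑-distrib-+ (λ _ → h) len ⟩
    sum {suc q} (λ _ → h) + sum len
      ≤⟨ +-mono-≤ (≤-reflexive (sum-const (suc q) h))
           -- Intervals start below `n` and have length at most `2 * n`, so `3 * n` positions hold
           -- them whole.
           (sum-mono {suc q} (λ j → count-interval-≥ {3 * n} (covers? j) (x j) (len j) (fits j) (λ t lo hi → lo , hi))) ⟩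
    suc q * h + sum (λ j → count {3 * n} (covers? j))
      ≡⟨ cong (suc q * h +_) (∑-comm (λ j t → 𝟙 (covers? j t))) ⟩
    suc q * h + sum {3 * n} (λ t → count (λ j → covers? j t))
      ≤⟨ +-monoʳ-≤ (suc q * h) (sum-bound {3 * n} _ s (λ t →
           count-injection (λ j → covers? j t) strip (disjoint t))) ⟩
    suc q * h + 3 * n * s
      ≡⟨ +-comm (suc q * h) _ ⟩
    3 * n * s + suc q * h ∎
    where
    open ≤-Reasoning
    x y len : Fin (suc q) → ℕ
    x j = toℕ (lookup z j)
    y j = toℕ (π ⟨$⟩ʳ lookup z j)
    len j = neighbour z j ∸ h
    y/h<s : ∀ j → y j / h < s
    y/h<s j = m<n*o⇒m/o<n (<-≤-trans (Fin.toℕ<n (π ⟨$⟩ʳ lookup z j)) n≤sh)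
    strip : Fin (suc q) → Fin s
    strip j = fromℕ< (y/h<s j)
    covers? : ∀ j (t : Fin (3 * n)) → Dec (x j ≤ toℕ t × toℕ t < x j + len j)
    covers? j t = (x j ≤? toℕ t) ×-dec (toℕ t <? x j + len j)
    fits : ∀ j → x j + len j ≤ 3 * n
    fits j = +-mono-≤ (<⇒≤ (Fin.toℕ<n (lookup z j))) (≤-trans (m∸n≤m _ h) (nearest≤2n (lookup z j) (removeAt z j)))
    separated : ∀ {j k} → strip j ≡ strip k → j ≢ k → x j ≤ x k → x j + len j ≤ x k
    separated {j} {k} strips≡ j≢k xj≤xk = begin
      x j + len j                          ≤⟨ +-monoʳ-≤ (x j) (m≤n+o⇒m∸n≤o (neighbour z j) h
                                                (subst (neighbour z j ≤_) (+-comm _ h) close)) ⟩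
      x j + ∣ x j - x k ∣                  ≡⟨ cong (x j +_) (m≤n⇒∣m-n∣≡n∸m xj≤xk) ⟩
      x j + (x k ∸ x j)                    ≡⟨ m+[n∸m]≡n xj≤xk ⟩
      x k                                  ∎
      where
      -- Rows in one strip differ by at most `h`, which the subtraction of `h` in `len` makes up
      -- for.
      close : neighbour z j ≤ ∣ x j - x k ∣ + h
      close = ≤-trans (neighbour≤dist z j≢k) (+-monoʳ-≤ ∣ x j - x k ∣ (same-quotient⇒close h (y j) (y k)
        (trans (sym (Fin.toℕ-fromℕ< (y/h<s j))) (trans (cong toℕ strips≡) (Fin.toℕ-fromℕ< (y/h<s k))))))
    disjoint : ∀ t {j k} → x j ≤ toℕ t × toℕ t < x j + len j → x k ≤ toℕ t × toℕ t < x k + len k →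
               strip j ≡ strip k → j ≡ k
    disjoint t {j} {k} (xj≤t , t<j) (xk≤t , t<k) strips≡ with j Fin.≟ k | ≤-total (x j) (x k)
    ... | yes j≡k | _          = j≡k
    ... | no  j≢k | inj₁ xj≤xk =
      contradiction (<-≤-trans t<j (≤-trans (separated strips≡ j≢k xj≤xk) xk≤t)) (<-irrefl refl)
    ... | no  j≢k | inj₂ xk≤xj =
      contradiction (<-≤-trans t<k (≤-trans (separated (sym strips≡) (j≢k ∘ sym) xk≤xj) xj≤t)) (<-irrefl refl)

  -- A fresh point and the q sampled points are exchangeable.
  nearest-average : ∀ q s h .{{_ : NonZero h}} → n ≤ s * h →
    suc q * ∑ᵛ q (λ xs → sum (λ i → nearest i xs)) ≤ n ^ suc q * (3 * n * s + suc q * h)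
  nearest-average q s h n≤sh = begin
    suc q * ∑ᵛ q (λ xs → sum (λ i → nearest i xs))
      ≡⟨ cong (suc q *_) (sum-∑ᵛ-comm {n} q nearest) ⟨
    suc q * sum (λ x → ∑ᵛ q (nearest x))
      ≡⟨ sum-const (suc q) _ ⟨
    sum {suc q} (λ j → sum (λ x → ∑ᵛ q (nearest x)))
      ≡⟨ sum-cong-≗ {suc q} exchange ⟩
    sum {suc q} (λ j → ∑ᵛ (suc q) (λ z → neighbour z j))
      ≡⟨ sum-∑ᵛ-comm {suc q} (suc q) (λ j z → neighbour z j) ⟩
    ∑ᵛ (suc q) (λ z → sum (neighbour z))
      ≤⟨ ∑ᵛ-mono (suc q) (sum-neighbour s h n≤sh) ⟩
    ∑ᵛ {n} (suc q) (λ z → 3 * n * s + suc q * h)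
      ≡⟨ ∑ᵛ-const {n} (suc q) (3 * n * s + suc q * h) ⟩
    n ^ suc q * (3 * n * s + suc q * h) ∎
    where
    open ≤-Reasoning
    exchange : ∀ j → sum (λ x → ∑ᵛ q (nearest x)) ≡ ∑ᵛ (suc q) (λ z → neighbour z j)
    exchange j = sym (trans (∑ᵛ-insertAt q j (λ z → neighbour z j))
      (sum-cong-≗ {n} (λ x → ∑ᵛ-cong q (λ xs → cong₂ nearest (insertAt-lookup xs j x) (removeAt-insertAt xs j x)))))

-- Standardization and blow-ups

-- Pigeonhole: a missed value could be punched out, leaving an injection into a smaller set.
injective⇒surjective : (f : Fin n → Fin n) → (∀ {i j} → f i ≡ f j → i ≡ j) → ∀ y → ∃[ x ] f x ≡ y
injective⇒surjective {suc n} f inj y with Fin.any? (λ x → f x Fin.≟ y)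
... | yes w = w
... | no ∄ = contradiction (Fin.injective⇒≤ {f = λ x → punchOut (y≢f x)}
               (λ {i} {j} → inj ∘ Fin.punchOut-injective (y≢f i) (y≢f j))) 1+n≰n
  where
  y≢f : ∀ x → y ≢ f x
  y≢f x y≡fx = ∄ (x , sym y≡fx)

module _ (key : Fin n → ℕ) (key-injective : ∀ {i j} → key i ≡ key j → i ≡ j) where

  private
    rankℕ : Fin n → ℕ
    rankℕ i = count (λ j → key j <? key i)

    rankℕ-mono : ∀ {i j} → key i < key j → rankℕ i < rankℕ j
    rankℕ-mono {i} {j} ki<kj = sum-mono-< {n}
      (λ l → 𝟙-mono (key l <? key i) (key l <? key j) (λ kl<ki → <-trans kl<ki ki<kj)) i
      (subst₂ _<_ (sym (𝟙-no (key i <? key i) (<-irrefl refl))) (sym (𝟙-yes (key i <? key j) ki<kj)) z<s)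

    rankℕ<n : ∀ i → rankℕ i < n
    rankℕ<n i = subst (rankℕ i <_) (trans (sum-const n 1) (*-identityʳ n))
      (sum-mono-< {n} {g = λ _ → 1} (λ l → 𝟙≤1 (key l <? key i)) i
        (subst (_< 1) (sym (𝟙-no (key i <? key i) (<-irrefl refl))) z<s))

    rank : Fin n → Fin n
    rank i = fromℕ< (rankℕ<n i)

    rank-mono : ∀ {i j} → key i < key j → rank i Fin.< rank j
    rank-mono {i} {j} ki<kj =
      subst₂ _<_ (sym (Fin.toℕ-fromℕ< (rankℕ<n i))) (sym (Fin.toℕ-fromℕ< (rankℕ<n j))) (rankℕ-mono ki<kj)

    rank-injective : ∀ {i j} → rank i ≡ rank j → i ≡ j
    rank-injective {i} {j} ri≡rj with <-cmp (key i) (key j)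
    ... | tri< ki<kj _ _ = contradiction (rank-mono ki<kj) (<-irrefl (cong toℕ ri≡rj))
    ... | tri≈ _ ki≡kj _ = key-injective ki≡kj
    ... | tri> _ _ kj<ki = contradiction (rank-mono kj<ki) (<-irrefl (cong toℕ (sym ri≡rj)))

    unrank = injective⇒surjective rank rank-injective

  -- Later arguments rest on preservation and reflection of order, so the rank itself stays opaque.
  abstract
    standardize : Permutation′ n
    standardize = permutation rank (proj₁ ∘ unrank) (proj₂ ∘ unrank)
                    (λ i → rank-injective (proj₂ (unrank (rank i))))

    standardize-mono : ∀ {i j} → key i < key j → standardize ⟨$⟩ʳ i Fin.< standardize ⟨$⟩ʳ j
    standardize-mono = rank-mono

    standardize-reflects : ∀ {i j} → standardize ⟨$⟩ʳ i Fin.< standardize ⟨$⟩ʳ j → key i < key j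
    standardize-reflects {i} {j} si<sj with <-cmp (key i) (key j)
    ... | tri< ki<kj _ _ = ki<kj
    ... | tri≈ _ ki≡kj _ = contradiction si<sj (<-irrefl (cong (λ l → toℕ (rank l)) (key-injective ki≡kj)))
    ... | tri> _ _ kj<ki = contradiction si<sj (<-asym (rank-mono kj<ki))

  standardize-key-mono : ∀ {i j} → i Fin.< j → key (standardize ⟨$⟩ˡ i) < key (standardize ⟨$⟩ˡ j)
  standardize-key-mono i<j = standardize-reflects
    (subst₂ Fin._<_ (sym (inverseʳ standardize)) (sym (inverseʳ standardize)) i<j)

-- The points may be listed in any order: the first factor passes from a rank among the positions
-- back to the index, the second on to the rank of the value.
pattern-⊑ : (π : Permutation′ m) (x : Fin n → Fin m) (x-inj : ∀ {i j} → toℕ (x i) ≡ toℕ (x j) → i ≡ j)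
  (y-inj : ∀ {i j} → toℕ (π ⟨$⟩ʳ x i) ≡ toℕ (π ⟨$⟩ʳ x j) → i ≡ j) →
  (flip (standardize (toℕ ∘ x) x-inj) ∘ₚ standardize (λ i → toℕ (π ⟨$⟩ʳ x i)) y-inj) ⊑ π
pattern-⊑ π x x-inj y-inj =
  (λ j → x (standardize (toℕ ∘ x) x-inj ⟨$⟩ˡ j)) , standardize-key-mono (toℕ ∘ x) x-inj ,
  λ j l → mk⇔ (standardize-mono (λ i → toℕ (π ⟨$⟩ʳ x i)) y-inj) (standardize-reflects (λ i → toℕ (π ⟨$⟩ʳ x i)) y-inj)

enumerate : {A : Fin n → Set} (A? : ∀ i → Dec (A i)) → k ≤ count A? →
            Σ[ ι ∈ (Fin k → Fin n) ] (∀ {r s} → r Fin.< s → ι r Fin.< ι s) × (∀ r → A (ι r))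
enumerate {k = zero} A? _ = (λ ()) , (λ { {()} }) , λ ()
enumerate {suc n} {suc k} A? k≤ with A? Fin.zero
... | no _ = let ι , mono , ∈A = enumerate (A? ∘ Fin.suc) k≤ in
             Fin.suc ∘ ι , (λ r<s → s≤s (mono r<s)) , ∈A
... | yes a = let ι , mono , ∈A = enumerate (A? ∘ Fin.suc) (s≤s⁻¹ k≤) in
  (λ { Fin.zero → Fin.zero ; (Fin.suc r) → Fin.suc (ι r) }) ,
  (λ { {Fin.zero} {Fin.suc s} _ → z<s ; {Fin.suc r} {Fin.suc s} r<s → s≤s (mono (s≤s⁻¹ r<s)) }) ,
  (λ { Fin.zero → a ; (Fin.suc r) → ∈A r })

increasing⇒mono : (f : Fin (suc m) → ℕ) → (∀ j → f (inject₁ j) < f (Fin.suc j)) → ∀ {j l} → j Fin.≤ l → f j ≤ f l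
increasing⇒mono f inc {Fin.zero} {Fin.zero} _ = ≤-refl
increasing⇒mono {suc m} f inc {Fin.zero} {Fin.suc l} _ =
  ≤-trans (<⇒≤ (inc Fin.zero)) (increasing⇒mono (f ∘ Fin.suc) (inc ∘ Fin.suc) z≤n)
increasing⇒mono {suc m} f inc {Fin.suc j} {Fin.suc l} (s≤s j≤l) = increasing⇒mono (f ∘ Fin.suc) (inc ∘ Fin.suc) j≤l

least : ExcludedMiddle 0ℓ → (Q : ℕ → Set) → ∃ Q → ∃ (IsLeast Q)
least em Q (k , q) = <-rec (λ k → Q k → ∃ (IsLeast Q)) search k q
  where
  search : ∀ k → (∀ {j} → j < k → Q j → ∃ (IsLeast Q)) → Q k → ∃ (IsLeast Q)
  search k rec q with em {∃[ j ] j < k × Q j}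
  ... | yes (j , j<k , qj) = rec j<k qj
  ... | no ∄ = k , q , λ j qj → ≮⇒≥ (λ j<k → ∄ (j , j<k , qj))

-- In blocks of size n every i < n can be placed at offset i, whatever its block c i is.
module _ {α : Permutation′ m} {N} {α′ : Permutation′ N} (b : BlowUp α α′)
         (blockSize≡n : ∀ j → BlowUp.blockSize b j ≡ n) (c : Fin n → Fin m) where

  open BlowUp b

  private
    place< : ∀ i → start (inject₁ (c i)) + toℕ i < start (Fin.suc (c i))
    place< i = subst (start (inject₁ (c i)) + toℕ i <_) (m+[n∸m]≡n (<⇒≤ (increasing (c i))))
      (+-monoʳ-< (start (inject₁ (c i))) (subst (toℕ i <_) (sym (blockSize≡n (c i))) (Fin.toℕ<n i)))

    place<N : ∀ i → start (inject₁ (c i)) + toℕ i < N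
    place<N i = <-≤-trans (place< i) (subst (start (Fin.suc (c i)) ≤_) last
      (increasing⇒mono start increasing (Fin.≤fromℕ (Fin.suc (c i)))))

    place : Fin n → Fin N
    place i = fromℕ< (place<N i)

    place-inBlock : ∀ i → InBlock (c i) (place i)
    place-inBlock i = subst (start (inject₁ (c i)) ≤_) (sym toℕ-pos) (m≤m+n _ _)
                  , subst (_< start (Fin.suc (c i))) (sym toℕ-pos) (place< i)
      where toℕ-pos = Fin.toℕ-fromℕ< (place<N i)

    place-mono : ∀ {i j} → c i Fin.< c j → place i Fin.< place j
    place-mono {i} {j} ci<cj = <-≤-trans (place-inBlock i .proj₂)
      (≤-trans (increasing⇒mono start increasing (subst (suc (toℕ (c i)) ≤_) (sym (Fin.toℕ-inject₁ (c j))) ci<cj))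
               (place-inBlock j .proj₁))

    place-injective : ∀ {i j} → toℕ (place i) ≡ toℕ (place j) → i ≡ j
    place-injective {i} {j} e with Fin.<-cmp (c i) (c j)
    ... | tri< ci<cj _ _ = contradiction (place-mono ci<cj) (<-irrefl e)
    ... | tri> _ _ cj<ci = contradiction (place-mono cj<ci) (<-irrefl (sym e))
    ... | tri≈ _ ci≡cj _ = Fin.toℕ-injective (+-cancelˡ-≡ (start (inject₁ (c i))) _ _
      (trans (sym (Fin.toℕ-fromℕ< (place<N i))) (trans e (trans (Fin.toℕ-fromℕ< (place<N j))
        (cong (λ d → start (inject₁ d) + toℕ j) (sym ci≡cj))))))

    value-injective : ∀ {i j} → toℕ (α′ ⟨$⟩ʳ place i) ≡ toℕ (α′ ⟨$⟩ʳ place j) → i ≡ j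
    value-injective e = place-injective (cong toℕ (trans (sym (inverseˡ α′))
      (trans (cong (α′ ⟨$⟩ˡ_) (Fin.toℕ-injective e)) (inverseˡ α′))))

    value-mono : ∀ {i j} → α ⟨$⟩ʳ c i Fin.< α ⟨$⟩ʳ c j → α′ ⟨$⟩ʳ place i Fin.< α′ ⟨$⟩ʳ place j
    value-mono {i} {j} lt = Equivalence.from (order (place-inBlock j) (place-inBlock i) cj≢ci) lt
      where
      cj≢ci : c j ≢ c i
      cj≢ci e = <-irrefl (cong (λ d → toℕ (α ⟨$⟩ʳ d)) (sym e)) lt

  -- The number of `i` in the fibre of `c` over a block is the weight of that block, so one blow-up
  -- with blocks of size `n` contains every reweighting of total weight `n`. Heredity puts the
  -- selection in `P`; its ranks of positions and values are `φ` and `ψ`.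
  select : ∀ P → Hereditary P → P N α′ → 1 ≤ n →
    ∃[ φ ] ∃[ ψ ] P n (flip φ ∘ₚ ψ)
      × (∀ {i j} → c i Fin.< c j → φ ⟨$⟩ʳ i Fin.< φ ⟨$⟩ʳ j)
      × (∀ {i j} → α ⟨$⟩ʳ c i Fin.< α ⟨$⟩ʳ c j → ψ ⟨$⟩ʳ i Fin.< ψ ⟨$⟩ʳ j)
  select P hereditary Pα′ 1≤n =
    standardize _ place-injective , standardize _ value-injective ,
    hereditary _ α′ 1≤n (pattern-⊑ α′ place place-injective value-injective) Pα′ ,
    (λ ci<cj → standardize-mono _ place-injective (place-mono ci<cj)) ,
    (λ lt → standardize-mono _ value-injective (value-mono lt))

-- Dense cells and good samples

-- The member of `P` is given by the column `φ i` and the row `ψ i` of its `i`-th point, so that it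
-- can be compared with `π` point by point. Tied coordinates are left in any order, like the points
-- inside a block.
Realises : PermutationProperty → (Fin n → Fin n × Fin n) → Set
Realises {n} P point = Σ[ φ ∈ Permutation′ n ] Σ[ ψ ∈ Permutation′ n ] P n (flip φ ∘ₚ ψ)
  × (∀ {i j} → proj₁ (point i) Fin.< proj₁ (point j) → φ ⟨$⟩ʳ i Fin.< φ ⟨$⟩ʳ j)
  × (∀ {i j} → proj₂ (point i) Fin.< proj₂ (point j) → ψ ⟨$⟩ʳ i Fin.< ψ ⟨$⟩ʳ j)

combine-quotient-remainder : ∀ {l} k (p : Fin (l * k)) → toℕ p ≡ k * toℕ (quotient {l} k p) + toℕ (remainder {l} k p)
combine-quotient-remainder {l} k p = trans (cong toℕ (sym (Fin.combine-remQuot {l} k p)))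
                                         (Fin.toℕ-combine (quotient {l} k p) (remainder {l} k p))

quotient-unique : ∀ {l} k (p : Fin (l * k)) (c : Fin l) → toℕ c * k ≤ toℕ p →
                  toℕ p < suc (toℕ c) * k → quotient {l} k p ≡ c
quotient-unique {l} k p c ≤p p< = Fin.toℕ-injective (≤-antisym
  (s≤s⁻¹ (*-cancelʳ-< k _ _ (≤-<-trans (≤-trans (≤-reflexive (*-comm (toℕ c′) k)) (m≤m+n _ _))
    (subst (_< suc (toℕ c) * k) p≡ p<))))
  (s≤s⁻¹ (*-cancelʳ-< k (toℕ c) _ (≤-<-trans ≤p (subst (_< suc (toℕ c′) * k) (sym p≡)
    (subst (k * toℕ c′ + toℕ (remainder {l} k p) <_) (trans (+-comm _ k) (cong (k +_) (*-comm k (toℕ c′))))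
      (+-monoʳ-< (k * toℕ c′) (Fin.toℕ<n (remainder {l} k p)))))))))
  where
  c′ = quotient {l} k p
  p≡ = combine-quotient-remainder {l} k p

uniformBlowUp : ∀ {l k} (α : Permutation′ l) (α′ : Permutation′ (l * k)) → 1 ≤ k →
  (∀ {p p′} → quotient {l} k p ≢ quotient {l} k p′ →
    (α′ ⟨$⟩ʳ p Fin.> α′ ⟨$⟩ʳ p′) ⇔ (α ⟨$⟩ʳ quotient {l} k p Fin.> α ⟨$⟩ʳ quotient {l} k p′)) →
  IsUniformBlowUp k α α′
uniformBlowUp {l} {k} α α′ 1≤k order =
  record
    { start = λ j → toℕ j * k
    ; first = refl
    ; last = cong (_* k) (Fin.toℕ-fromℕ l)
    ; increasing = λ j → subst (λ t → t * k < k + toℕ j * k) (sym (Fin.toℕ-inject₁ j)) (+-monoˡ-≤ (toℕ j * k) 1≤k)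
    ; order = λ {j₁} {j₂} {i₁} {i₂} ∈j₁ ∈j₂ j₁≢j₂ → blockOrder (inBlock j₁ i₁ ∈j₁) (inBlock j₂ i₂ ∈j₂) j₁≢j₂
    } ,
  λ j → trans (cong (λ t → k + toℕ j * k ∸ t * k) (Fin.toℕ-inject₁ j)) (m+n∸n≡m k (toℕ j * k))
  where
  inBlock : ∀ (j : Fin l) (i : Fin (l * k)) → toℕ (inject₁ j) * k ≤ toℕ i × toℕ i < suc (toℕ j) * k →
            quotient {l} k i ≡ j
  inBlock j i (≤i , i<) = quotient-unique k i j (subst (λ t → t * k ≤ toℕ i) (Fin.toℕ-inject₁ j) ≤i) i<
  blockOrder : ∀ {j₁ j₂ i₁ i₂} → quotient {l} k i₁ ≡ j₁ → quotient {l} k i₂ ≡ j₂ → j₁ ≢ j₂ →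
    (α′ ⟨$⟩ʳ i₁ Fin.> α′ ⟨$⟩ʳ i₂) ⇔ (α ⟨$⟩ʳ j₁ Fin.> α ⟨$⟩ʳ j₂)
  blockOrder refl refl j₁≢j₂ = order j₁≢j₂

module Grid (π : Permutation′ n) (strip : Fin n → Fin m)
            (strip-mono : ∀ {i j} → i Fin.≤ j → strip i Fin.≤ strip j) (K : ℕ) where

  col row : Fin n → Fin m
  col = strip
  row i = strip (π ⟨$⟩ʳ i)

  strip-reflects : ∀ {i j} → strip i Fin.< strip j → i Fin.< j
  strip-reflects si<sj = ≰⇒> (λ j≤i → <⇒≱ si<sj (strip-mono j≤i))

  strip-mono-< : ∀ {i j} → strip i ≢ strip j → i Fin.< j → strip i Fin.< strip j
  strip-mono-< si≢sj i<j = ≤∧≢⇒< (strip-mono (<⇒≤ i<j)) (si≢sj ∘ Fin.toℕ-injective)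

  cellmate? : ∀ i j → Dec (col j ≡ col i × row j ≡ row i)
  cellmate? i j = (col j Fin.≟ col i) ×-dec (row j Fin.≟ row i)

  Dense : Fin n → Set
  Dense i = K ≤ count (cellmate? i)

  Separated : Fin n → Fin n → Set
  Separated i j = col i ≢ col j × row i ≢ row j

  module _ (x : Fin l → Fin n) (dense : ∀ c → Dense (x c)) (separated : ∀ {c d} → c ≢ d → Separated (x c) (x d)) where

    private
      col-injective : ∀ {c d} → toℕ (col (x c)) ≡ toℕ (col (x d)) → c ≡ d
      col-injective {c} {d} e with c Fin.≟ d
      ... | yes c≡d = c≡d
      ... | no  c≢d = contradiction (Fin.toℕ-injective e) (separated c≢d .proj₁)

      -- This renumbers the sample from left to right; `α` is the pattern of the rows in that order.
      byCol = standardize (toℕ ∘ col ∘ x) col-injective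

      x′ : Fin l → Fin n
      x′ c = x (byCol ⟨$⟩ˡ c)

      col-mono : ∀ {c d} → c Fin.< d → col (x′ c) Fin.< col (x′ d)
      col-mono = standardize-key-mono (toℕ ∘ col ∘ x) col-injective

      row-injective : ∀ {c d} → toℕ (row (x′ c)) ≡ toℕ (row (x′ d)) → c ≡ d
      row-injective {c} {d} e with byCol ⟨$⟩ˡ c Fin.≟ byCol ⟨$⟩ˡ d
      ... | yes c≡d = trans (sym (inverseʳ byCol)) (trans (cong (byCol ⟨$⟩ʳ_) c≡d) (inverseʳ byCol))
      ... | no  c≢d = contradiction (Fin.toℕ-injective e) (separated c≢d .proj₂)

      α : Permutation′ l
      α = standardize (toℕ ∘ row ∘ x′) row-injective

      α-mono : ∀ {c d} → row (x′ c) Fin.< row (x′ d) → α ⟨$⟩ʳ c Fin.< α ⟨$⟩ʳ d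
      α-mono = standardize-mono (toℕ ∘ row ∘ x′) row-injective

      α-reflects : ∀ {c d} → α ⟨$⟩ʳ c Fin.< α ⟨$⟩ʳ d → row (x′ c) Fin.< row (x′ d)
      α-reflects = standardize-reflects (toℕ ∘ row ∘ x′) row-injective

    -- Take `k` points from each of the `l` dense cells. The cells lie in distinct columns and
    -- distinct rows, so points of different cells compare as their strips do.
    blowUp-⊑ : 1 ≤ k → k ≤ K → ∃[ α′ ] IsUniformBlowUp k {n = l * k} α α′ × α′ ⊑ π
    blowUp-⊑ {k} 1≤k k≤K =
      α′ , uniformBlowUp α α′ 1≤k order , ι , ι-mono , λ p p′ →
        mk⇔ (standardize-mono _ value-injective) (standardize-reflects _ value-injective)
      where
      members = λ c → enumerate (cellmate? (x′ c)) (≤-trans k≤K (dense (byCol ⟨$⟩ˡ c)))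
      ι : Fin (l * k) → Fin n
      ι p = members (quotient {l} k p) .proj₁ (remainder {l} k p)
      ι-col : ∀ p → col (ι p) ≡ col (x′ (quotient {l} k p))
      ι-col p = members (quotient {l} k p) .proj₂ .proj₂ (remainder {l} k p) .proj₁
      ι-row : ∀ p → row (ι p) ≡ row (x′ (quotient {l} k p))
      ι-row p = members (quotient {l} k p) .proj₂ .proj₂ (remainder {l} k p) .proj₂
      quotient-< : ∀ {p p′} → quotient {l} k p Fin.< quotient {l} k p′ → p Fin.< p′
      quotient-< {p} {p′} c<c′ = subst₂ Fin._<_ (Fin.combine-remQuot {l} k p) (Fin.combine-remQuot {l} k p′)
        (Fin.combine-monoˡ-< (remainder {l} k p) (remainder {l} k p′) c<c′)
      ι-mono : ∀ {p p′} → p Fin.< p′ → ι p Fin.< ι p′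
      ι-mono {p} {p′} p<p′ with Fin.<-cmp (quotient {l} k p) (quotient {l} k p′)
      ... | tri< c<c′ _ _ = strip-reflects (subst₂ Fin._<_ (sym (ι-col p)) (sym (ι-col p′)) (col-mono c<c′))
      ... | tri> _ _ c′<c = contradiction p<p′ (<-asym (quotient-< c′<c))
      ... | tri≈ _ c≡c′ _ = subst (λ c → members c .proj₁ (remainder {l} k p) Fin.< ι p′) (sym c≡c′)
        (members (quotient {l} k p′) .proj₂ .proj₁ (+-cancelˡ-< (k * toℕ (quotient {l} k p′)) _ _
          (subst₂ _<_ (trans (combine-quotient-remainder {l} k p) (cong (λ c → k * toℕ c + toℕ (remainder {l} k p)) c≡c′))
                      (combine-quotient-remainder {l} k p′) p<p′)))
      value-injective : ∀ {p p′} → toℕ (π ⟨$⟩ʳ ι p) ≡ toℕ (π ⟨$⟩ʳ ι p′) → p ≡ p′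
      value-injective {p} {p′} e with Fin.<-cmp p p′ |
          trans (sym (inverseˡ π)) (trans (cong (π ⟨$⟩ˡ_) (Fin.toℕ-injective e)) (inverseˡ π))
      ... | tri< p<p′ _ _ | ιp≡ιp′ = contradiction (ι-mono p<p′) (<-irrefl (cong toℕ ιp≡ιp′))
      ... | tri≈ _ p≡p′ _ | _      = p≡p′
      ... | tri> _ _ p′<p | ιp≡ιp′ = contradiction (ι-mono p′<p) (<-irrefl (cong toℕ (sym ιp≡ιp′)))
      α′ : Permutation′ (l * k)
      α′ = standardize (λ p → toℕ (π ⟨$⟩ʳ ι p)) value-injective
      rows : ∀ {p p′} → row (x′ (quotient {l} k p)) Fin.< row (x′ (quotient {l} k p′)) → α′ ⟨$⟩ʳ p Fin.< α′ ⟨$⟩ʳ p′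
      rows {p} {p′} lt = standardize-mono _ value-injective
        (strip-reflects (subst₂ Fin._<_ (sym (ι-row p)) (sym (ι-row p′)) lt))
      order : ∀ {p p′} → quotient {l} k p ≢ quotient {l} k p′ →
              (α′ ⟨$⟩ʳ p Fin.> α′ ⟨$⟩ʳ p′) ⇔ (α ⟨$⟩ʳ quotient {l} k p Fin.> α ⟨$⟩ʳ quotient {l} k p′)
      order {p} {p′} c≢c′ = mk⇔ to (λ lt → rows (α-reflects lt))
        where
        to : α′ ⟨$⟩ʳ p′ Fin.< α′ ⟨$⟩ʳ p → α ⟨$⟩ʳ quotient {l} k p′ Fin.< α ⟨$⟩ʳ quotient {l} k p
        to lt with Fin.<-cmp (row (x′ (quotient {l} k p′))) (row (x′ (quotient {l} k p)))
        ... | tri< r′<r _ _ = α-mono r′<r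
        ... | tri≈ _ r′≡r _ = contradiction (sym (row-injective (cong toℕ r′≡r))) c≢c′
        ... | tri> _ _ r<r′ = contradiction lt (<-asym (rows r<r′))

    module _ (em : ExcludedMiddle 0ℓ) {P : PermutationProperty} (hereditary : Hereditary P)
             (maxK : IsMaxK* P l K) (Pπ : P n π) (1≤l : 1 ≤ l) where

      private
        Avoids : ℕ → Set
        Avoids k = 1 ≤ k × (∀ N (α′ : Permutation′ N) → IsUniformBlowUp k α α′ → ¬ P N α′)

      -- The least avoided `k` would be the value `k*(α)`, hence at most `K` by maximality. But then
      -- `blowUp-⊑` finds a `k`-blow-up inside `π`, and heredity puts it in `P`.
      K*≡∞ : ¬ ∃ Avoids
      K*≡∞ w with least em Avoids w
      ... | k , isK@((1≤k , avoids) , _) =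
        let α′ , isBlowUp , α′⊑π = blowUp-⊑ 1≤k (maxK .proj₂ α k isK)
        in avoids _ α′ isBlowUp (hereditary α′ π (*-mono-≤ 1≤l 1≤k) α′⊑π Pπ)

      blowUp∈P : ∀ k → 1 ≤ k → ∃[ N ] Σ[ α′ ∈ Permutation′ N ] IsUniformBlowUp k α α′ × P N α′
      blowUp∈P k 1≤k with em {∃[ N ] Σ[ α′ ∈ Permutation′ N ] IsUniformBlowUp k α α′ × P N α′}
      ... | yes w = w
      ... | no ∄ = contradiction (k , 1≤k , λ N α′ isBlowUp Pα′ → ∄ (N , α′ , isBlowUp , Pα′)) K*≡∞

      -- All weights are at most `n`, so an `n`-blow-up of `α` in `P` provides them. Sample points
      -- that differ in a coordinate have different indices and so lie in different strips, which
      -- carries the order of coordinates over to the blocks and to `α`.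
      realises : 1 ≤ n → (a : Fin n → Fin l) → Realises P (λ i → x (a i) , π ⟨$⟩ʳ x (a i))
      realises 1≤n a =
        let _ , _ , (b , blockSize≡n) , Pα′ = blowUp∈P n 1≤n
            φ , ψ , Pσ , φ-mono , ψ-mono = select b blockSize≡n (λ i → byCol ⟨$⟩ʳ a i) P hereditary Pα′ 1≤n
        in φ , ψ , Pσ
         , (λ xi<xj → φ-mono (standardize-mono _ col-injective
              (strip-mono-< (separated (λ e → <-irrefl (cong (toℕ ∘ x) e) xi<xj) .proj₁) xi<xj)))
         , (λ yi<yj → ψ-mono (α-mono (subst₂ (λ i j → row (x i) Fin.< row (x j))
              (sym (inverseˡ byCol)) (sym (inverseˡ byCol))
              (strip-mono-< (separated (λ e → <-irrefl (cong (λ c → toℕ (π ⟨$⟩ʳ x c)) e) yi<yj) .proj₂) yi<yj))))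

  -- Counting bad samples and extending good ones

  sparse? : ∀ i → Dec (¬ Dense i)
  sparse? i = ¬? (K ≤? count (cellmate? i))

  conflict? : ∀ i j → Dec (col j ≡ col i ⊎ row j ≡ row i)
  conflict? i j = (col j Fin.≟ col i) ⊎-dec (row j Fin.≟ row i)

  -- There are `m * m` cells, and a cell that contains a sparse point has fewer than `K` points
  -- altogether.
  count-sparse : count sparse? ≤ m * m * K
  count-sparse = begin
    count sparse?                                            ≡⟨ count-fibres sparse? cell ⟩
    sum {m * m} (λ c → count (λ i → sparse? i ×-dec (cell i Fin.≟ c)))  ≤⟨ sum-bound {m * m} _ K fibre≤K ⟩
    m * m * K                                                ∎
    where
    open ≤-Reasoning
    cell : Fin n → Fin (m * m)
    cell i = combine (col i) (row i)
    fibre≤K : ∀ c → count (λ i → sparse? i ×-dec (cell i Fin.≟ c)) ≤ K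
    fibre≤K c with Fin.any? (λ i → sparse? i ×-dec (cell i Fin.≟ c))
    ... | no ∄ = ≤-trans
      (≤-reflexive (sum-all-0 {n} _ (λ i → 𝟙-no (sparse? i ×-dec (cell i Fin.≟ c)) (λ s → ∄ (i , s))))) z≤n
    ... | yes (i , sparse , refl) = ≤-trans
      (count-mono (λ j → sparse? j ×-dec (cell j Fin.≟ cell i)) (cellmate? i)
        (λ j (_ , e) → Fin.combine-injective (col j) (row j) (col i) (row i) e))
      (<⇒≤ (≰⇒> sparse))

  Admissible : Fin n → Vec (Fin n) q → Set
  Admissible i xs = Dense i × (∀ a → Separated i (lookup xs a))

  Good : Vec (Fin n) q → Set
  Good []       = ⊤
  Good (x ∷ xs) = Admissible x xs × Good xs

  admissible? : ∀ i (xs : Vec (Fin n) q) → Dec (Admissible i xs)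
  admissible? i xs = (K ≤? count (cellmate? i)) ×-dec
    Fin.all? (λ a → ¬? (col i Fin.≟ col (lookup xs a)) ×-dec ¬? (row i Fin.≟ row (lookup xs a)))

  good? : (xs : Vec (Fin n) q) → Dec (Good xs)
  good? []       = yes tt
  good? (x ∷ xs) = admissible? x xs ×-dec good? xs

  Good⇒dense : (xs : Vec (Fin n) q) → Good xs → ∀ c → Dense (lookup xs c)
  Good⇒dense (x ∷ xs) ((dense , _) , _) Fin.zero    = dense
  Good⇒dense (x ∷ xs) (_ , good)        (Fin.suc c) = Good⇒dense xs good c

  Good⇒separated : (xs : Vec (Fin n) q) → Good xs → ∀ {c d} → c ≢ d → Separated (lookup xs c) (lookup xs d)
  Good⇒separated (x ∷ xs) _ {Fin.zero} {Fin.zero} c≢d = contradiction refl c≢d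
  Good⇒separated (x ∷ xs) ((_ , sep) , _) {Fin.zero} {Fin.suc d} c≢d = sep d
  Good⇒separated (x ∷ xs) ((_ , sep) , _) {Fin.suc c} {Fin.zero} c≢d = let cols , rows = sep c in cols ∘ sym , rows ∘ sym
  Good⇒separated (x ∷ xs) (_ , good) {Fin.suc c} {Fin.suc d} c≢d = Good⇒separated xs good (c≢d ∘ cong Fin.suc)

  module _ (w : ℕ) (strip-count : ∀ c → count (λ j → strip j Fin.≟ c) ≤ w) where

    count-conflict : ∀ i → count (conflict? i) ≤ 2 * w
    count-conflict i = begin
      count (conflict? i)
        ≤⟨ sum-mono {n} (λ j → 𝟙-union (conflict? i j) (col j Fin.≟ col i) (row j Fin.≟ row i) (λ c → c)) ⟩
      sum (λ j → 𝟙 (col j Fin.≟ col i) + 𝟙 (row j Fin.≟ row i))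
        ≡⟨ ∑-distrib-+ (λ j → 𝟙 (col j Fin.≟ col i)) (λ j → 𝟙 (row j Fin.≟ row i)) ⟩
      count (λ j → col j Fin.≟ col i) + count (λ j → row j Fin.≟ row i)
        ≡⟨ cong (count (λ j → col j Fin.≟ col i) +_) (sum-permute (λ j → 𝟙 (strip j Fin.≟ row i)) π) ⟨
      count (λ j → strip j Fin.≟ col i) + count (λ j → strip j Fin.≟ row i)
        ≤⟨ +-mono-≤ (strip-count (col i)) (≤-trans (strip-count (row i)) (≤-reflexive (sym (+-identityʳ w)))) ⟩
      2 * w ∎
      where open ≤-Reasoning

    count-inadmissible : (xs : Vec (Fin n) q) → count (λ i → ¬? (admissible? i xs)) ≤ m * m * K + q * (2 * w)
    count-inadmissible {q} xs = begin
      count (λ i → ¬? (admissible? i xs))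
        ≤⟨ sum-mono {n} (λ i → 𝟙-bound (¬? (admissible? i xs)) (reason i)) ⟩
      sum (λ i → 𝟙 (sparse? i) + sum {q} (λ a → 𝟙 (conflict? (lookup xs a) i)))
        ≡⟨ ∑-distrib-+ (𝟙 ∘ sparse?) (λ i → sum {q} (λ a → 𝟙 (conflict? (lookup xs a) i))) ⟩
      count sparse? + sum (λ i → sum {q} (λ a → 𝟙 (conflict? (lookup xs a) i)))
        ≡⟨ cong (count sparse? +_) (∑-comm (λ i a → 𝟙 (conflict? (lookup xs a) i))) ⟩
      count sparse? + sum {q} (λ a → count (conflict? (lookup xs a)))
        ≤⟨ +-mono-≤ count-sparse (sum-bound {q} _ (2 * w) (λ a → count-conflict (lookup xs a))) ⟩
      m * m * K + q * (2 * w) ∎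
      where
      open ≤-Reasoning
      reason : ∀ i → ¬ Admissible i xs → 1 ≤ 𝟙 (sparse? i) + sum {q} (λ a → 𝟙 (conflict? (lookup xs a) i))
      reason i inadmissible with K ≤? count (cellmate? i) | Fin.any? (λ a → conflict? (lookup xs a) i)
      ... | no sparse | _ = ≤-trans (≤-reflexive (sym (𝟙-yes (sparse? i) sparse))) (m≤m+n _ _)
      ... | yes dense | yes (a , c) = ≤-trans (≤-reflexive (sym (𝟙-yes (conflict? (lookup xs a) i) c)))
          (≤-trans (sum-≥ {q} (λ a → 𝟙 (conflict? (lookup xs a) i)) a) (m≤n+m _ (𝟙 (sparse? i))))
      ... | yes dense | no ∄ = contradiction (dense , λ a → (λ e → ∄ (a , inj₁ e)) , (λ e → ∄ (a , inj₂ e))) inadmissible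

    -- Union bound over the draws: next to `j` points at most `m * m * K + 2 * j * w` choices are
    -- inadmissible, and the sum of `2 * j` over `j < q` is at most `q * q`.
    count-bad : ∀ q → n * ∑ᵛ q (λ xs → 𝟙 (¬? (good? xs))) ≤ n ^ q * (q * (m * m * K) + q * q * w)
    count-bad zero = ≤-trans (≤-reflexive (*-zeroʳ n)) z≤n
    count-bad (suc q) = begin
      n * sum (λ x → ∑ᵛ q (λ xs → bad (x ∷ xs)))
        ≤⟨ *-monoʳ-≤ n (sum-mono {n} (λ x → ∑ᵛ-mono q (λ xs →
             𝟙-union (¬? (good? (x ∷ xs))) (¬? (admissible? x xs)) (¬? (good? xs)) (split x xs)))) ⟩
      n * sum (λ x → ∑ᵛ q (λ xs → new x xs + bad xs))
        ≡⟨ cong (n *_) (sum-cong-≗ {n} (λ x → ∑ᵛ-distrib-+ q (new x) bad)) ⟩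
      n * sum (λ x → ∑ᵛ q (new x) + ∑ᵛ q bad)
        ≡⟨ cong (n *_) (∑-distrib-+ (λ x → ∑ᵛ q (new x)) (λ _ → ∑ᵛ q bad)) ⟩
      n * (sum (λ x → ∑ᵛ q (new x)) + sum {n} (λ _ → ∑ᵛ q bad))
        ≡⟨ cong₂ (λ a b → n * (a + b)) (sum-∑ᵛ-comm {n} q new) (sum-const n (∑ᵛ q bad)) ⟩
      n * (∑ᵛ q (λ xs → sum (λ x → new x xs)) + n * ∑ᵛ q bad)
        ≤⟨ *-monoʳ-≤ n (+-mono-≤ (∑ᵛ-mono q count-inadmissible) (count-bad q)) ⟩
      n * (∑ᵛ {n} q (λ _ → S + q * (2 * w)) + n ^ q * (q * S + q * q * w))
        ≡⟨ cong (λ z → n * (z + n ^ q * (q * S + q * q * w))) (∑ᵛ-const {n} q (S + q * (2 * w))) ⟩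
      n * (n ^ q * (S + q * (2 * w)) + n ^ q * (q * S + q * q * w))
        -- The added `w` completes `q * q + 2 * q` to `suc q * suc q`.
        ≤⟨ m≤m+n _ (n * n ^ q * w) ⟩
      n * (n ^ q * (S + q * (2 * w)) + n ^ q * (q * S + q * q * w)) + n * n ^ q * w
        ≡⟨ identity n (n ^ q) S q w ⟩
      n * n ^ q * (suc q * S + suc q * suc q * w) ∎
      where
      open ≤-Reasoning
      S = m * m * K
      bad : ∀ {q} → Vec (Fin n) q → ℕ
      bad xs = 𝟙 (¬? (good? xs))
      new : Fin n → Vec (Fin n) q → ℕ
      new x xs = 𝟙 (¬? (admissible? x xs))
      split : ∀ x (xs : Vec (Fin n) q) → ¬ Good (x ∷ xs) → ¬ Admissible x xs ⊎ ¬ Good xs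
      split x xs ¬good with admissible? x xs
      ... | no ¬adm = inj₁ ¬adm
      ... | yes adm = inj₂ (λ good → ¬good (adm , good))
      identity : ∀ n N S q w → n * (N * (S + q * (2 * w)) + N * (q * S + q * q * w)) + n * N * w
                 ≡ n * N * (suc q * S + suc q * suc q * w)
      identity = solve-∀

    -- Greedy choice: `room` keeps the number of inadmissible points below `n` at every stage, so
    -- some point remains.
    extend : ∀ r (xs : Vec (Fin n) q) → Good xs → m * m * K + (r + q) * (2 * w) < n →
             Σ[ ys ∈ Vec (Fin n) r ] Good (ys ++ xs)
    extend zero xs good _ = [] , good
    extend {q} (suc r) xs good room =
      let ys , good′ = extend r xs good (≤-<-trans (+-monoʳ-≤ (m * m * K) (m≤n+m _ (2 * w))) room)
          y , ¬¬adm = count-< (λ i → ¬? (admissible? i (ys ++ xs)))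
            (≤-<-trans (count-inadmissible (ys ++ xs)) (≤-<-trans (+-monoʳ-≤ (m * m * K) (m≤n+m _ (2 * w))) room))
      in y ∷ ys , decidable-stable (admissible? y (ys ++ xs)) ¬¬adm , good′

    -- The bound `K` concerns patterns of length `r + q`, so the sample is first extended to that
    -- length. Shifting `a` by `r ↑ʳ_` gives the added points weight 0.
    Good⇒realises : ExcludedMiddle 0ℓ → {P : PermutationProperty} → Hereditary P → ∀ r →
      IsMaxK* P (r + q) K → P n π → 1 ≤ q → 1 ≤ n → m * m * K + (r + q) * (2 * w) < n →
      (xs : Vec (Fin n) q) → Good xs → (a : Fin n → Fin q) →
      Realises P (λ i → lookup xs (a i) , π ⟨$⟩ʳ lookup xs (a i))
    Good⇒realises em {P} hereditary r maxK Pπ 1≤q 1≤n room xs good a =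
      let ys , good′ = extend r xs good room
          zs = ys ++ xs
          φ , ψ , Pσ , φ-mono , ψ-mono = realises (lookup zs) (Good⇒dense zs good′) (Good⇒separated zs good′)
            em hereditary maxK Pπ (≤-trans 1≤q (m≤n+m _ r)) 1≤n (λ i → r ↑ʳ a i)
          at = λ i → sym (lookup-++ʳ ys xs (a i))
      in φ , ψ , Pσ , (λ {i} {j} lt → φ-mono (subst₂ Fin._<_ (at i) (at j) lt))
       , (λ {i} {j} lt → ψ-mono (subst₂ (λ u v → π ⟨$⟩ʳ u Fin.< π ⟨$⟩ʳ v) (at i) (at j) lt))

-- Rationals, cuts and acceptance probabilities

ι : ℕ → ℚ
ι n = fromℤ (ℤ.+ n)

ι-homo-+ : ∀ a b → ι (a + b) ≡ ι a ℚ.+ ι b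
ι-homo-+ a b = ℚ.toℚᵘ-injective (ℚᵘ.≃-trans (*≡* (cong (ℤ._* ℤ.+ 1)
    (cong₂ (λ x y → x ℤ.+ y) (sym (ℤ.*-identityʳ (ℤ.+ a))) (sym (ℤ.*-identityʳ (ℤ.+ b))))))
  (ℚᵘ.≃-sym (ℚ.toℚᵘ-homo-+ (ι a) (ι b))))

ι-homo-* : ∀ a b → ι (a * b) ≡ ι a ℚ.* ι b
ι-homo-* a b = ℚ.toℚᵘ-injective (ℚᵘ.≃-trans (*≡* (cong (ℤ._* ℤ.+ 1) (ℤ.pos-* a b)))
  (ℚᵘ.≃-sym (ℚ.toℚᵘ-homo-* (ι a) (ι b))))

ι-mono-≤ : ∀ {a b} → a ≤ b → ι a ℚ.≤ ι b
ι-mono-≤ a≤b = ℚ.*≤* (ℤ.*-monoʳ-≤-nonNeg (ℤ.+ 1) (ℤ.+≤+ a≤b))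

ι-cancel-≤ : ∀ {a b} → ι a ℚ.≤ ι b → a ≤ b
ι-cancel-≤ {a} {b} (ℚ.*≤* le) = ℤ.drop‿+≤+ (subst₂ ℤ._≤_ (ℤ.*-identityʳ (ℤ.+ a)) (ℤ.*-identityʳ (ℤ.+ b)) le)

ι-cancel-< : ∀ {a b} → ι a ℚ.< ι b → a < b
ι-cancel-< {a} {b} lt = ≰⇒> (λ b≤a → ℚ.<-irrefl refl (ℚ.<-≤-trans lt (ι-mono-≤ b≤a)))

ι-nonNeg : ∀ n → ℚ.NonNegative (ι n)
ι-nonNeg n = _

ι-pos : ∀ {n} → 1 ≤ n → ℚ.Positive (ι n)
ι-pos (s≤s _) = _

ι-/ : ∀ a d → ι (suc d) ℚ.* (ℤ.+ a ℚ./ suc d) ≡ ι a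
ι-/ a d = ℚ.toℚᵘ-injective (ℚᵘ.≃-trans (ℚ.toℚᵘ-homo-* (ι (suc d)) (ℤ.+ a ℚ./ suc d))
  (ℚᵘ.≃-trans (ℚᵘ.*-congˡ {toℚᵘ (ι (suc d))} (ℚ.toℚᵘ-fromℚᵘ (mkℚᵘ (ℤ.+ a) d)))
    (*≡* (trans (ℤ.*-identityʳ (ℤ.+ suc d ℤ.* ℤ.+ a)) (trans (ℤ.*-comm (ℤ.+ suc d) (ℤ.+ a))
      (cong (λ k → ℤ.+ a ℤ.* ℤ.+ k) (sym (*-identityˡ (suc d)))))))))

fraction : ∀ p → 0ℚ ℚ.< p → ∃[ a ] ∃[ b ] 1 ≤ a × 1 ≤ b × ι b ℚ.* p ≡ ι a
fraction p@(mkℚ ℤ.+[1+ a ] d _) _ = suc a , suc d , s≤s z≤n , s≤s z≤n ,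
  trans (cong (ι (suc d) ℚ.*_) (sym (ℚ.↥p/↧p≡p p))) (ι-/ (suc a) d)
fraction (mkℚ (ℤ.+ 0) d _) (ℚ.*<* (ℤ.+<+ ()))
fraction (mkℚ ℤ.-[1+ n ] d _) (ℚ.*<* ())

fraction-<1 : ∀ {p a b} → p ℚ.< 1ℚ → 1 ≤ b → ι b ℚ.* p ≡ ι a → a ≤ b
fraction-<1 {p} {a} {b} p<1 1≤b e = ι-cancel-≤ (subst₂ ℚ._≤_ e (ℚ.*-identityʳ (ι b))
  (ℚ.*-monoˡ-≤-nonNeg (ι b) {{ι-nonNeg b}} (ℚ.<⇒≤ p<1)))

∉-≥0 : ∀ x {s} → ¬ Below x s → 0ℚ ℚ.≤ s
∉-≥0 x s∉ = ℚ.≮⇒≥ (λ s<0 → s∉ (negative x s<0))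

-- Roundedness of the cut makes the inequality strict: a further rational above `r` still lies below
-- `x`.
∉-> : ∀ x {r s} → Below x r → ¬ Below x s → r ℚ.< s
∉-> x r∈ s∉ = let r′ , r<r′ , r′∈ = rounded x r∈ in
  ℚ.<-≤-trans r<r′ (ℚ.≮⇒≥ (λ s<r′ → s∉ (lower x s<r′ r′∈)))

-- `¬ Below x s` expresses `x ≤ s`. Such bounds are never negative, so they can be multiplied.
∉-* : ∀ x y {s t} → ¬ Below x s → ¬ Below y t → ¬ Below (x *ᵣ y) (s ℚ.* t)
∉-* x y {s} {t} s∉ t∉ (inj₁ st<0) = ℚ.<-irrefl refl (ℚ.<-≤-trans st<0
  (subst (ℚ._≤ s ℚ.* t) (ℚ.*-zeroʳ s) (ℚ.*-monoˡ-≤-nonNeg s {{ℚ.nonNegative (∉-≥0 x s∉)}} (∉-≥0 y t∉))))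
∉-* x y {s} {t} s∉ t∉ (inj₂ (a , b , 0≤a , 0≤b , a∈ , b∈ , st<ab)) = ℚ.<-irrefl refl (ℚ.<-≤-trans st<ab
  (ℚ.≤-trans (ℚ.*-monoʳ-≤-nonNeg b {{ℚ.nonNegative 0≤b}} (ℚ.<⇒≤ (∉-> x a∈ s∉)))
             (ℚ.*-monoˡ-≤-nonNeg s {{ℚ.nonNegative (∉-≥0 x s∉)}} (ℚ.<⇒≤ (∉-> y b∈ t∉)))))

power : ℚ → ℕ → ℚ
power p zero    = ι 1
power p (suc k) = p ℚ.* power p k

∉-^ : ∀ x {p} k → ¬ Below x p → ¬ Below (x ^ᵣ k) (power p k)
∉-^ x zero    p∉ = ℚ.<-irrefl refl
∉-^ x (suc k) p∉ = ∉-* x (x ^ᵣ k) p∉ (∉-^ x k p∉)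

-- If `s * m < c`, some rational `A` fits between. As `x ≤ s`, the number `m / A` lies below
-- `1 / x`, and so does some larger `B`. From `A < c` and `m < A * B` it follows that `m` lies
-- strictly below `c / x`, a contradiction.
quotient-≤ : ∀ c m x {{x>0 : Positive x}} {s} → fromℕᵣ c /ᵣ x ≤ᵣ fromℕᵣ m → ¬ Below x s → ι c ℚ.≤ s ℚ.* ι m
quotient-≤ c m x {{x>0}} {s} c/x≤m s∉ = ℚ.≮⇒≥ λ sm<c →
  let A , sm<A , A<c = ℚ.<-dense sm<c
      0<A = ℚ.≤-<-trans 0≤sm sm<A
      instance
        A-nonZero = ℚ.pos⇒nonZero A {{ℚ.positive 0<A}}
      r = ℚ.1/ A
      r-pos = ℚ.1/pos⇒pos A {{ℚ.positive 0<A}}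
      mrs<1 : ι m ℚ.* r ℚ.* s ℚ.< 1ℚ
      mrs<1 = subst₂ ℚ._<_ (trans (ℚ.*-comm (s ℚ.* ι m) r) (trans (cong (r ℚ.*_) (ℚ.*-comm s (ι m)))
                  (trans (sym (ℚ.*-assoc r (ι m) s)) (cong (ℚ._* s) (ℚ.*-comm r (ι m)))))) (ℚ.*-inverseʳ A)
                (ℚ.*-monoˡ-<-pos r {{r-pos}} sm<A)
      B , mr<B , B∈ = rounded (inverse x x>0) (s , s∉ , mrs<1)
      0≤mr = subst (ℚ._≤ ι m ℚ.* r) (ℚ.*-zeroˡ r)
        (ℚ.*-monoʳ-≤-nonNeg r {{ℚ.pos⇒nonNeg r {{r-pos}}}} (ι-mono-≤ (z≤n {m})))
      m<AB : ι m ℚ.< A ℚ.* B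
      m<AB = subst (ℚ._< A ℚ.* B) (trans (ℚ.*-comm A _) (trans (ℚ.*-assoc (ι m) r A)
               (trans (cong (ι m ℚ.*_) (ℚ.*-inverseˡ A)) (ℚ.*-identityʳ (ι m)))))
               (ℚ.*-monoʳ-<-pos A {{ℚ.positive 0<A}} mr<B)
  in ℚ.<-irrefl refl (c/x≤m (ι m) (inj₂ (A , B , ℚ.<⇒≤ 0<A , ℚ.≤-trans 0≤mr (ℚ.<⇒≤ mr<B) , A<c , B∈ , m<AB)))
  where
  0≤sm : 0ℚ ℚ.≤ s ℚ.* ι m
  0≤sm = subst (ℚ._≤ s ℚ.* ι m) (ℚ.*-zeroʳ s)
           (ℚ.*-monoˡ-≤-nonNeg s {{ℚ.nonNegative (∉-≥0 x s∉)}} (ι-mono-≤ (z≤n {m})))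

power-fraction : ∀ {p a b} k → ι b ℚ.* p ≡ ι a → ι (b ^ k) ℚ.* power p k ≡ ι (a ^ k)
power-fraction zero _ = refl
power-fraction {p} {a} {b} (suc k) e = begin
  ι (b * b ^ k) ℚ.* (p ℚ.* power p k)             ≡⟨ cong (ℚ._* (p ℚ.* power p k)) (ι-homo-* b (b ^ k)) ⟩
  ι b ℚ.* ι (b ^ k) ℚ.* (p ℚ.* power p k)         ≡⟨ interchange (ι b) (ι (b ^ k)) p (power p k) ⟩
  ι b ℚ.* p ℚ.* (ι (b ^ k) ℚ.* power p k)         ≡⟨ cong₂ ℚ._*_ e (power-fraction {p} {a} {b} k e) ⟩
  ι a ℚ.* ι (a ^ k)                               ≡⟨ ι-homo-* a (a ^ k) ⟨
  ι (a * a ^ k)                                   ∎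
  where
  open ≡-Reasoning
  open CommutativeSemigroup (CommutativeMonoid.commutativeSemigroup ℚ.*-1-commutativeMonoid) using (interchange)

-- For the upper bound `p = a / b` of `x` this is `c ≤ p ^ k * m` with the denominators cleared; the
-- estimates that use it stay in the natural numbers.
quotient-^-≤ : ∀ c m k x {{_ : Positive (x ^ᵣ k)}} {p a b} → fromℕᵣ c /ᵣ (x ^ᵣ k) ≤ᵣ fromℕᵣ m →
               ¬ Below x p → ι b ℚ.* p ≡ ι a → c * b ^ k ≤ a ^ k * m
quotient-^-≤ c m k x {p} {a} {b} le p∉ e = ι-cancel-≤ (begin
  ι (c * b ^ k)                       ≡⟨ trans (ι-homo-* c (b ^ k)) (ℚ.*-comm (ι c) (ι (b ^ k))) ⟩
  ι (b ^ k) ℚ.* ι c                   ≤⟨ ℚ.*-monoˡ-≤-nonNeg (ι (b ^ k)) {{ι-nonNeg (b ^ k)}}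
                                           (quotient-≤ c m (x ^ᵣ k) le (∉-^ x k p∉)) ⟩
  ι (b ^ k) ℚ.* (power p k ℚ.* ι m)   ≡⟨ ℚ.*-assoc (ι (b ^ k)) (power p k) (ι m) ⟨
  ι (b ^ k) ℚ.* power p k ℚ.* ι m     ≡⟨ cong (ℚ._* ι m) (power-fraction {p} {a} {b} k e) ⟩
  ι (a ^ k) ℚ.* ι m                   ≡⟨ ι-homo-* (a ^ k) m ⟨
  ι (a ^ k * m)                       ∎)
  where open ℚ.≤-Reasoning

ratio-< : ∀ {p a b t} N → 0ℚ ℚ.< p → 1 ≤ b → ι b ℚ.* p ≡ ι a → p ℚ.< ratio t N → a * N < b * t
-- `ratio` is 0 for denominator 0, which `0 < p` excludes.
ratio-< zero 0<p _ _ p<0 = contradiction p<0 (ℚ.<-asym 0<p)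
ratio-< {p} {a} {b} {t} N@(suc d) 0<p 1≤b e p<t/N = ι-cancel-< (begin-strict
  ι (a * N)                           ≡⟨ ι-homo-* a N ⟩
  ι a ℚ.* ι N                         ≡⟨ cong (ℚ._* ι N) e ⟨
  ι b ℚ.* p ℚ.* ι N                   <⟨ ℚ.*-monoˡ-<-pos (ι N) (ℚ.*-monoʳ-<-pos (ι b) {{ι-pos 1≤b}} p<t/N) ⟩
  ι b ℚ.* (ℤ.+ t ℚ./ N) ℚ.* ι N         ≡⟨ ℚ.*-assoc (ι b) (ℤ.+ t ℚ./ N) (ι N) ⟩
  ι b ℚ.* ((ℤ.+ t ℚ./ N) ℚ.* ι N)       ≡⟨ cong (ι b ℚ.*_) (trans (ℚ.*-comm (ℤ.+ t ℚ./ N) (ι N)) (ι-/ t d)) ⟩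
  ι b ℚ.* ι t                         ≡⟨ ι-homo-* b t ⟨
  ι (b * t)                           ∎)
  where open ℚ.≤-Reasoning

ratio≤1 : ∀ {t} N → t ≤ N → ratio t N ℚ.≤ 1ℚ
ratio≤1 zero t≤N = ℚ.<⇒≤ (ℚ.positive⁻¹ 1ℚ)
ratio≤1 {t} (suc d) t≤N = ℚ.*-cancelˡ-≤-pos (ι (suc d))
  (subst₂ ℚ._≤_ (sym (ι-/ t d)) (sym (ℚ.*-identityʳ (ι (suc d)))) (ι-mono-≤ t≤N))

-- Sampling algorithms and their success probability

module _ {n : ℕ} where

  private N = suc n

  sample : ∀ {Q} r → r ≤ Q → (Vec (Fin N × Fin N) r → Bool) → Algorithm N Q
  sample zero    _         decide = output (decide [])
  sample (suc r) (s≤s r≤Q) decide =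
    toss n λ i → query i λ v → sample r r≤Q (λ points → decide ((i , v) ∷ points))

  module _ (π : Permutation′ N) where

    points : ∀ {r} → Vec (Fin N) r → Vec (Fin N × Fin N) r
    points = map (λ i → i , π ⟨$⟩ʳ i)

    private
      ∑ℚ-*ˡ : ∀ {m} c (f : Fin m → ℚ) → ∑ℚ.sum (λ i → c ℚ.* f i) ≡ c ℚ.* ∑ℚ.sum f
      ∑ℚ-*ˡ {zero}  c f = sym (ℚ.*-zeroʳ c)
      ∑ℚ-*ˡ {suc m} c f = trans (cong (c ℚ.* f Fin.zero ℚ.+_) (∑ℚ-*ˡ c (f ∘ Fin.suc)))
                                (sym (ℚ.*-distribˡ-+ c (f Fin.zero) _))

      ι-sum : ∀ {m} (f : Fin m → ℕ) → ι (sum f) ≡ ∑ℚ.sum (ι ∘ f)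
      ι-sum {zero}  f = refl
      ι-sum {suc m} f = trans (ι-homo-+ (f Fin.zero) _) (cong (ι (f Fin.zero) ℚ.+_) (ι-sum (f ∘ Fin.suc)))

    probability-sample : ∀ {Q} r (r≤Q : r ≤ Q) decide v →
      ι (N ^ r) ℚ.* probability (sample r r≤Q decide) π v ≡ ι (∑ᵛ r (λ xs → 𝟙 (decide (points xs) Bool.≟ v)))
    probability-sample zero r≤Q decide v with decide [] Bool.≟ v
    ... | yes _ = refl
    ... | no _  = refl
    probability-sample {suc Q} (suc r) (s≤s r≤Q) decide v = begin
      ι (N * N ^ r) ℚ.* ((ℤ.+ 1 ℚ./ N) ℚ.* S)          ≡⟨ cong (ℚ._* ((ℤ.+ 1 ℚ./ N) ℚ.* S))
                                                          (trans (cong ι (*-comm N (N ^ r))) (ι-homo-* (N ^ r) N)) ⟩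
      ι (N ^ r) ℚ.* ι N ℚ.* ((ℤ.+ 1 ℚ./ N) ℚ.* S)      ≡⟨ ℚ.*-assoc (ι (N ^ r)) (ι N) _ ⟩
      ι (N ^ r) ℚ.* (ι N ℚ.* ((ℤ.+ 1 ℚ./ N) ℚ.* S))    ≡⟨ cong (ι (N ^ r) ℚ.*_) (ℚ.*-assoc (ι N) (ℤ.+ 1 ℚ./ N) S) ⟨
      ι (N ^ r) ℚ.* (ι N ℚ.* (ℤ.+ 1 ℚ./ N) ℚ.* S)      ≡⟨ cong (λ z → ι (N ^ r) ℚ.* (z ℚ.* S)) (ι-/ 1 n) ⟩
      ι (N ^ r) ℚ.* (1ℚ ℚ.* S)                       ≡⟨ cong (ι (N ^ r) ℚ.*_) (ℚ.*-identityˡ S) ⟩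
      ι (N ^ r) ℚ.* S                                ≡⟨ ∑ℚ-*ˡ (ι (N ^ r)) prob ⟨
      ∑ℚ.sum (λ i → ι (N ^ r) ℚ.* prob i)            ≡⟨ ∑ℚ.sum-cong-≗ (λ i → probability-sample r r≤Q (decideAfter i) v) ⟩
      ∑ℚ.sum (λ i → ι (hits i))                      ≡⟨ ι-sum hits ⟨
      ι (sum hits)                                   ∎
      where
      open ≡-Reasoning
      decideAfter : Fin N → Vec (Fin N × Fin N) r → Bool
      decideAfter i ps = decide ((i , π ⟨$⟩ʳ i) ∷ ps)
      prob : Fin N → ℚ
      prob i = probability (sample r r≤Q (decideAfter i)) π v
      hits : Fin N → ℕ
      hits i = ∑ᵛ r (λ xs → 𝟙 (decideAfter i (points xs) Bool.≟ v))
      S = ∑ℚ.sum prob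

    -- The hypothesis is about misses because these are what the union bound and Markov's inequality
    -- limit.
    likely : ∀ {Q} r (r≤Q : r ≤ Q) decide v → 3 * ∑ᵛ r (λ xs → 𝟙 (¬? (decide (points xs) Bool.≟ v))) ≤ N ^ r →
             ℤ.+ 2 ℚ./ 3 ℚ.≤ probability (sample r r≤Q decide) π v
    likely r r≤Q decide v misses≤ = ℚ.*-cancelˡ-≤-pos (ι (N ^ r)) {{ι-pos (m^n>0 N r)}}
      (ℚ.*-cancelˡ-≤-pos (ι 3) (begin
        ι 3 ℚ.* (ι (N ^ r) ℚ.* (ℤ.+ 2 ℚ./ 3))   ≡⟨ cong (ι 3 ℚ.*_) (ℚ.*-comm (ι (N ^ r)) (ℤ.+ 2 ℚ./ 3)) ⟩
        ι 3 ℚ.* ((ℤ.+ 2 ℚ./ 3) ℚ.* ι (N ^ r))   ≡⟨ ℚ.*-assoc (ι 3) (ℤ.+ 2 ℚ./ 3) (ι (N ^ r)) ⟨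
        ι 2 ℚ.* ι (N ^ r)                     ≡⟨ ι-homo-* 2 (N ^ r) ⟨
        ι (2 * N ^ r)                         ≤⟨ ι-mono-≤ 2N≤3hits ⟩
        ι (3 * hits)                          ≡⟨ ι-homo-* 3 hits ⟩
        ι 3 ℚ.* ι hits                        ≡⟨ cong (ι 3 ℚ.*_) (probability-sample r r≤Q decide v) ⟨
        ι 3 ℚ.* (ι (N ^ r) ℚ.* probability (sample r r≤Q decide) π v) ∎))
      where
      open ℚ.≤-Reasoning
      hits misses : ℕ
      hits = ∑ᵛ r (λ xs → 𝟙 (decide (points xs) Bool.≟ v))
      misses = ∑ᵛ r (λ xs → 𝟙 (¬? (decide (points xs) Bool.≟ v)))
      complement : ∀ {A : Set} (a? : Dec A) → 𝟙 a? + 𝟙 (¬? a?) ≡ 1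
      complement (yes _) = refl
      complement (no _)  = refl
      total : hits + misses ≡ N ^ r
      total = trans (sym (∑ᵛ-distrib-+ r (λ xs → 𝟙 (decide (points xs) Bool.≟ v))
        (λ xs → 𝟙 (¬? (decide (points xs) Bool.≟ v)))))
        (trans (∑ᵛ-cong r (λ xs → complement (decide (points xs) Bool.≟ v))) (trans (∑ᵛ-const {N} r 1) (*-identityʳ _)))
      2N≤3hits : 2 * N ^ r ≤ 3 * hits
      2N≤3hits = +-cancelʳ-≤ (N ^ r) _ _ (≤-trans (≤-reflexive (trans (+-comm (2 * N ^ r) (N ^ r))
        (trans (cong (3 *_) (sym total)) (*-distribˡ-+ 3 hits misses)))) (+-monoʳ-≤ (3 * hits) misses≤))

-- Numerical estimates

≤-parts : ∀ n d .{{_ : NonZero d}} → n ≤ d * suc (n / d)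
≤-parts n d = begin
  n                     ≡⟨ m≡m%n+[m/n]*n n d ⟩
  n % d + n / d * d     ≤⟨ +-monoˡ-≤ _ (<⇒≤ (m%n<n n d)) ⟩
  d + n / d * d         ≡⟨ *-comm (suc (n / d)) d ⟩
  d * suc (n / d)       ∎
  where open ≤-Reasoning

parts-≤ : ∀ n d .{{_ : NonZero d}} → d * suc (n / d) ≤ n + d
parts-≤ n d = begin
  d * suc (n / d)       ≡⟨ *-comm d (suc (n / d)) ⟩
  d + n / d * d         ≤⟨ +-monoʳ-≤ d (m/n*n≤m n d) ⟩
  d + n                 ≡⟨ +-comm d n ⟩
  n + d                 ∎
  where open ≤-Reasoning

module _ {n M K q w : ℕ} (2q≤M : 2 * q ≤ M) (1≤K : 1 ≤ K) (4≤M : 4 ≤ M)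
         (long : 32 * M ^ 5 * K ≤ n) (width : M * M * w ≤ n + M * M) where

  private
    -- With `M * M` strips each way there are `M ^ 4` cells, and `T` bounds the number of points in
    -- sparse ones.
    T = M * M * (M * M) * K

    32MT≤n : 32 * (M * T) ≤ n
    32MT≤n = ≤-trans (≤-reflexive (identity M K)) long
      where
      identity : ∀ M K → 32 * (M * (M * M * (M * M) * K)) ≡ 32 * (M * (M * (M * (M * (M * 1))))) * K
      identity = solve-∀

    1≤M : 1 ≤ M
    1≤M = ≤-trans (s≤s z≤n) 4≤M

    32T≤n : 32 * T ≤ n
    32T≤n = ≤-trans (*-monoʳ-≤ 32 (≤-trans (≤-reflexive (sym (*-identityˡ T))) (*-monoˡ-≤ T 1≤M))) 32MT≤n

    MM≤T : M * M ≤ T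
    MM≤T = begin
      M * M                ≡⟨ identity (M * M) ⟩
      M * M * 1 * 1        ≤⟨ *-mono-≤ (*-monoʳ-≤ (M * M) (*-mono-≤ 1≤M 1≤M)) 1≤K ⟩
      M * M * (M * M) * K  ∎
      where
      open ≤-Reasoning
      identity : ∀ x → x ≡ x * 1 * 1
      identity = solve-∀

    32MMw≤33n : 32 * (M * M * w) ≤ 33 * n
    32MMw≤33n = begin
      32 * (M * M * w)       ≤⟨ *-monoʳ-≤ 32 width ⟩
      32 * (n + M * M)       ≡⟨ *-distribˡ-+ 32 n (M * M) ⟩
      32 * n + 32 * (M * M)  ≤⟨ +-monoʳ-≤ (32 * n) (≤-trans (*-monoʳ-≤ 32 MM≤T) 32T≤n) ⟩
      32 * n + n             ≡⟨ +-comm (32 * n) n ⟩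
      33 * n                 ∎
      where open ≤-Reasoning

    1≤n : 1 ≤ n
    1≤n = ≤-trans (*-mono-≤ {1} {32} (s≤s z≤n) (≤-trans (*-mono-≤ 1≤M 1≤M) MM≤T)) 32T≤n

  -- Relative to `n`, the term with `T` is at most 6/128, from `q ≤ M / 2` and `32 * M * T ≤ n`; the
  -- term with `w` is at most 3/4 of 33/32, that is 99/128.
  bad-samples-≤ : 3 * (q * T + q * q * w) ≤ n
  bad-samples-≤ = *-cancelˡ-≤ 128 (begin
    128 * (3 * (q * T + q * q * w))                          ≡⟨ identity q T w ⟩
    3 * (2 * (32 * (2 * q * T)) + 32 * (2 * q * (2 * q) * w))  ≤⟨ *-monoʳ-≤ 3 (+-mono-≤
        (*-monoʳ-≤ 2 (≤-trans (*-monoʳ-≤ 32 (*-monoˡ-≤ T 2q≤M)) 32MT≤n))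
        (≤-trans (*-monoʳ-≤ 32 (*-monoˡ-≤ w (*-mono-≤ 2q≤M 2q≤M))) 32MMw≤33n)) ⟩
    3 * (2 * n + 33 * n)                                     ≡⟨ sums n ⟩
    105 * n                                                  ≤⟨ *-monoˡ-≤ n {105} {128} (m≤m+n 105 23) ⟩
    128 * n                                                  ∎)
    where
    open ≤-Reasoning
    identity : ∀ q T w → 128 * (3 * (q * T + q * q * w)) ≡ 3 * (2 * (32 * (2 * q * T)) + 32 * (2 * q * (2 * q) * w))
    identity = solve-∀
    sums : ∀ n → 3 * (2 * n + 33 * n) ≡ 105 * n
    sums = solve-∀

  -- By `4 ≤ M`, the term with `w` is at most half of `M * M * w`, hence 33/64 of `n`, and `T` takes
  -- at most 2/64.
  room-to-extend : T + M * (2 * w) < n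
  room-to-extend = *-cancelˡ-< 64 (T + M * (2 * w)) n (begin-strict
    64 * (T + M * (2 * w))           ≡⟨ identity T M w ⟩
    2 * (32 * T) + 32 * (4 * M * w)  ≤⟨ +-mono-≤ (*-monoʳ-≤ 2 32T≤n)
        (≤-trans (*-monoʳ-≤ 32 (*-monoˡ-≤ w (*-monoˡ-≤ M 4≤M))) 32MMw≤33n) ⟩
    2 * n + 33 * n                   <⟨ m<m+n (2 * n + 33 * n) 1≤n ⟩
    2 * n + 33 * n + n               ≤⟨ m≤m+n (2 * n + 33 * n + n) (28 * n) ⟩
    2 * n + 33 * n + n + 28 * n      ≡⟨ sums n ⟩
    64 * n                           ∎)
    where
    open ≤-Reasoning
    identity : ∀ T M w → 64 * (T + M * (2 * w)) ≡ 2 * (32 * T) + 32 * (4 * M * w)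
    identity = solve-∀
    sums : ∀ n → 2 * n + 33 * n + n + 28 * n ≡ 64 * n
    sums = solve-∀

-- a / b stands for ε; about 50 / ε strips balance the two error terms 3 n s and N h.
module _ {a b M N n : ℕ} {{a≢0 : NonZero a}} (a≤b : a ≤ b) (M≤2N : M ≤ 2 * N)
         (large : 20000 * b ^ 2 ≤ a ^ 2 * M) (long : 32 * M ≤ suc n) (1≤M : 1 ≤ M) where

  strips height : ℕ
  strips = suc (50 * b / a)
  height = suc (suc n / strips)

  private
    as≤51b : a * strips ≤ 51 * b
    as≤51b = ≤-trans (parts-≤ (50 * b) a) (≤-trans (+-monoʳ-≤ (50 * b) a≤b) (≤-reflexive (+-comm (50 * b) b)))

    strips≤M : strips ≤ M
    strips≤M = *-cancelˡ-≤ a (*-cancelˡ-≤ a (begin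
      a * (a * strips)    ≤⟨ *-monoʳ-≤ a as≤51b ⟩
      a * (51 * b)        ≤⟨ *-mono-≤ a≤b (*-monoˡ-≤ b {51} {20000} (m≤m+n 51 19949)) ⟩
      b * (20000 * b)     ≡⟨ rearrange b 20000 ⟩
      20000 * b ^ 2       ≤⟨ large ⟩
      a ^ 2 * M           ≡⟨ square a M ⟩
      a * (a * M)         ∎))
      where
      open ≤-Reasoning
      rearrange : ∀ b c → b * (c * b) ≡ c * (b * (b * 1))
      rearrange = solve-∀
      square : ∀ a M → a * (a * 1) * M ≡ a * (a * M)
      square = solve-∀

    10000bb≤aaN : 10000 * (b * b) ≤ a * (a * N)
    10000bb≤aaN = *-cancelˡ-≤ 2 (begin
      2 * (10000 * (b * b))    ≡⟨ *-assoc 2 10000 (b * b) ⟨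
      20000 * (b * b)          ≡⟨ cong (λ x → 20000 * (b * x)) (*-identityʳ b) ⟨
      20000 * b ^ 2            ≤⟨ large ⟩
      a ^ 2 * M                ≤⟨ *-monoʳ-≤ (a ^ 2) M≤2N ⟩
      a ^ 2 * (2 * N)          ≡⟨ rearrange a N ⟩
      2 * (a * (a * N))        ∎)
      where
      open ≤-Reasoning
      rearrange : ∀ a N → a * (a * 1) * (2 * N) ≡ 2 * (a * (a * N))
      rearrange = solve-∀

    -- A second factor `b` comes from `strips ≤ 51 * b / a`, and `10000 * b * b ≤ a * a * N` absorbs
    -- both; 3672 is 72 * 51.
    horizontal : 10000 * (72 * b * suc n * strips) ≤ 3672 * (a * N * suc n)
    horizontal = *-cancelˡ-≤ a (begin
      a * (10000 * (72 * b * suc n * strips))       ≡⟨ lhs a b (suc n) strips 10000 ⟩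
      72 * 10000 * b * suc n * (a * strips)         ≤⟨ *-monoʳ-≤ (72 * 10000 * b * suc n) as≤51b ⟩
      72 * 10000 * b * suc n * (51 * b)             ≡⟨ middle b (suc n) 10000 ⟩
      3672 * suc n * (10000 * (b * b))              ≤⟨ *-monoʳ-≤ (3672 * suc n) 10000bb≤aaN ⟩
      3672 * suc n * (a * (a * N))                  ≡⟨ rhs a N (suc n) 3672 ⟩
      a * (3672 * (a * N * suc n))                  ∎)
      where
      open ≤-Reasoning
      lhs : ∀ a b n s c → a * (c * (72 * b * n * s)) ≡ 72 * c * b * n * (a * s)
      lhs = solve-∀
      middle : ∀ b n c → 72 * c * b * n * (51 * b) ≡ 3672 * n * (c * (b * b))
      middle = solve-∀
      rhs : ∀ a N n c → c * n * (a * (a * N)) ≡ a * (c * (a * N * n))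
      rhs = solve-∀

    -- Here `50 * b ≤ a * strips` trades `b` for `strips`, and 4800 is 24 * 10000 / 50.
    vertical : 10000 * (24 * b * N * height) ≤ 4800 * (a * N * (suc n + strips))
    vertical = begin
      10000 * (24 * b * N * height)         ≡⟨ lhs b N height 200 ⟩
      24 * 200 * N * height * (50 * b)      ≤⟨ *-monoʳ-≤ (24 * 200 * N * height) (≤-parts (50 * b) a) ⟩
      24 * 200 * N * height * (a * strips)  ≡⟨ rhs a N height strips 4800 ⟩
      4800 * (a * N * (strips * height))    ≤⟨ *-monoʳ-≤ 4800 (*-monoʳ-≤ (a * N) (parts-≤ (suc n) strips)) ⟩
      4800 * (a * N * (suc n + strips))     ∎
      where
      open ≤-Reasoning
      lhs : ∀ b N h c → c * 50 * (24 * b * N * h) ≡ 24 * c * N * h * (50 * b)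
      lhs = solve-∀
      rhs : ∀ a N h s c → c * N * h * (a * s) ≡ c * (a * N * (s * h))
      rhs = solve-∀

    -- The two errors take 3672 + 4800 = 8472 parts in 10000; the other 1528 absorb the terms of
    -- order `M`, since `31 * M ≤ n`.
    slack : 3672 * suc n + 4800 * (suc n + strips) ≤ 10000 * n
    slack = begin
      3672 * suc n + 4800 * (suc n + strips)   ≡⟨ lhs n strips 3672 4800 ⟩
      8472 * n + (8472 * 1 + 4800 * strips)    ≤⟨ +-monoʳ-≤ (8472 * n) (+-mono-≤
                                                  (*-monoʳ-≤ 8472 1≤M) (*-monoʳ-≤ 4800 strips≤M)) ⟩
      8472 * n + (8472 * M + 4800 * M)         ≡⟨ cong (8472 * n +_) (*-distribʳ-+ M 8472 4800) ⟨
      8472 * n + 13272 * M                     ≤⟨ +-monoʳ-≤ (8472 * n) (*-monoˡ-≤ M {13272} {1528 * 31} (m≤m+n 13272 34096)) ⟩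
      8472 * n + 1528 * 31 * M                 ≡⟨ cong (8472 * n +_) (*-assoc 1528 31 M) ⟩
      8472 * n + 1528 * (31 * M)               ≤⟨ +-monoʳ-≤ (8472 * n) (*-monoʳ-≤ 1528 31M≤n) ⟩
      8472 * n + 1528 * n                      ≡⟨ *-distribʳ-+ n 8472 1528 ⟨
      10000 * n                                ∎
      where
      open ≤-Reasoning
      lhs : ∀ n s c d → c * suc n + d * (suc n + s) ≡ (c + d) * n + ((c + d) * 1 + d * s)
      lhs = solve-∀
      31M≤n : 31 * M ≤ n
      31M≤n = s≤s⁻¹ (≤-trans (+-monoˡ-≤ (31 * M) 1≤M) long)

  sampling-error-≤ : 24 * b * (3 * suc n * strips + N * height) ≤ a * n * N
  sampling-error-≤ = *-cancelˡ-≤ 10000 (begin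
    10000 * (24 * b * (3 * suc n * strips + N * height))
      ≡⟨ lhs b (suc n) strips N height 10000 ⟩
    10000 * (72 * b * suc n * strips) + 10000 * (24 * b * N * height)
      ≤⟨ +-mono-≤ horizontal vertical ⟩
    3672 * (a * N * suc n) + 4800 * (a * N * (suc n + strips))
      ≡⟨ collect (a * N) (suc n) strips 3672 4800 ⟩
    a * N * (3672 * suc n + 4800 * (suc n + strips))
      ≤⟨ *-monoʳ-≤ (a * N) slack ⟩
    a * N * (10000 * n)
      ≡⟨ rhs a N n 10000 ⟩
    10000 * (a * n * N) ∎)
    where
    open ≤-Reasoning
    lhs : ∀ b n s N h c → c * (24 * b * (3 * n * s + N * h)) ≡ c * (72 * b * n * s) + c * (24 * b * N * h)
    lhs = solve-∀
    collect : ∀ x n s c d → c * (x * n) + d * (x * (n + s)) ≡ x * (c * n + d * (n + s))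
    collect = solve-∀
    rhs : ∀ a N n c → a * N * (c * n) ≡ c * (a * n * N)
    rhs = solve-∀

-- The tester

-- Bubble sort of `π` into a member takes at most `n C 2` transpositions. The bound disposes of `ε`
-- at least 1 and yields `a ≤ b` otherwise.
distance≤1 : ∀ {P} {π : Permutation′ n} {d} → IsDistance P π d → d ℚ.≤ 1ℚ
distance≤1 {n} {P} {π} (inj₁ ((σ , _ , t , (_ , t-least) , refl) , _)) =
  let u , u≤ , path = bubbleSort π (π ∘ₚ flip σ)
      π⇝σ = Path-respʳ {σ = flip (π ∘ₚ flip σ) ∘ₚ π} {σ} (λ _ → inverseʳ π) path
  in ratio≤1 (n C 2) (≤-trans (t-least u π⇝σ) (≤-trans u≤ (inversions≤nC2 (π ∘ₚ flip σ))))
distance≤1 (inj₂ (_ , refl)) = ℚ.≤-refl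

-- The assignment a of the n points to the sample prescribes the weights of the blow-up.
Accepts : PermutationProperty → ∀ {n} → Vec (Fin n × Fin n) l → Set
Accepts {l} P {n} pairs = (a : Fin n → Fin l) → Realises P (λ i → lookup pairs (a i))

Realises-resp : ∀ {P} {f g : Fin n → Fin n × Fin n} → (∀ i → f i ≡ g i) → Realises P f → Realises P g
Realises-resp f≗g (φ , ψ , Pσ , φ-mono , ψ-mono) = φ , ψ , Pσ
  , (λ {i} {j} lt → φ-mono (subst₂ (λ u v → proj₁ u Fin.< proj₁ v) (sym (f≗g i)) (sym (f≗g j)) lt))
  , (λ {i} {j} lt → ψ-mono (subst₂ (λ u v → proj₂ u Fin.< proj₂ v) (sym (f≗g i)) (sym (f≗g j)) lt))

Accepts-points : ∀ {P n} (π : Permutation′ (suc n)) (xs : Vec (Fin (suc n)) l) →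
  (∀ a → Realises P (λ i → lookup xs (a i) , π ⟨$⟩ʳ lookup xs (a i))) → Accepts P (points π xs)
Accepts-points {P = P} π xs all a = Realises-resp {P = P} (λ i → sym (lookup-map (a i) _ xs)) (all a)

-- Assign each point to its nearest sample point. Acceptance gives a member of `P` of this shape,
-- which `π` reaches with at most 4 times the total distance in transpositions; farness makes that
-- number exceed `a / b` times `suc n C 2`.
accepted-far⇒costly : ExcludedMiddle 0ℓ → ∀ {P n} (π : Permutation′ (suc n)) {d p a b} →
  IsDistance P π d → p ℚ.< d → 0ℚ ℚ.< p → 1 ≤ b → ι b ℚ.* p ≡ ι a →
  (xs : Vec (Fin (suc n)) (suc l)) → Accepts P (points π xs) →
  a * (suc n * n) ≤ 8 * b * sum (λ i → nearest π i xs)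
accepted-far⇒costly em {P} {n} π {d} {p} {a} {b} isDistance p<d 0<p 1≤b p≡a/b xs accepted
  with accepted (λ i → nearest-attained π i xs .proj₁) | isDistance
-- Acceptance itself provides a member of this length, so the default distance 1 cannot occur.
... | φ , ψ , Pσ , _ , _ | inj₂ (¬P , _) = contradiction Pσ (¬P _)
... | φ , ψ , Pσ , φ-mono , ψ-mono | inj₁ (_ , d-least) = begin
  a * (suc n * n)            ≡⟨ cong (a *_) (2*nC2 (suc n)) ⟨
  a * (2 * (suc n C 2))      ≡⟨ swap₁ a (suc n C 2) ⟩
  2 * (a * (suc n C 2))      ≤⟨ *-monoʳ-≤ 2 (<⇒≤ (ratio-< (suc n C 2) 0<p 1≤b p≡a/b
                                  (ℚ.<-≤-trans p<d (d-least _ _ Pσ (t , isLeast , refl))))) ⟩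
  2 * (b * t)                ≤⟨ *-monoʳ-≤ 2 (*-monoʳ-≤ b (isLeast .proj₂ u path)) ⟩
  2 * (b * u)                ≤⟨ *-monoʳ-≤ 2 (*-monoʳ-≤ b u≤) ⟩
  2 * (b * (4 * sum (λ i → dist π i (s i))))
                             ≤⟨ *-monoʳ-≤ 2 (*-monoʳ-≤ b (*-monoʳ-≤ 4
                                  (sum-mono {suc n} (λ i → nearest-attained π i xs .proj₂)))) ⟩
  2 * (b * (4 * sum (λ i → nearest π i xs)))
                             ≡⟨ swap₂ b _ ⟩
  8 * b * sum (λ i → nearest π i xs) ∎
  where
  open ≤-Reasoning
  s : Fin (suc n) → Fin (suc n)
  s i = lookup xs (nearest-attained π i xs .proj₁)
  pair : ∀ i → lookup (points π xs) (nearest-attained π i xs .proj₁) ≡ (s i , π ⟨$⟩ʳ s i)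
  pair i = lookup-map (nearest-attained π i xs .proj₁) _ xs
  sorted = sortBoth-displacement π φ ψ (toℕ ∘ s) (λ i → toℕ (π ⟨$⟩ʳ s i))
    (λ {i} {j} lt → φ-mono (subst₂ (λ u v → proj₁ u Fin.< proj₁ v) (sym (pair i)) (sym (pair j)) lt))
    (λ {i} {j} lt → ψ-mono (subst₂ (λ u v → proj₂ u Fin.< proj₂ v) (sym (pair i)) (sym (pair j)) lt))
  u = sorted .proj₁
  u≤ = sorted .proj₂ .proj₁
  path = sorted .proj₂ .proj₂
  minimal = least em (λ t → Path t π (flip φ ∘ₚ ψ)) (u , path)
  t = minimal .proj₁
  isLeast = minimal .proj₂
  swap₁ : ∀ a x → a * (2 * x) ≡ 2 * (a * x)
  swap₁ = solve-∀
  swap₂ : ∀ b x → 2 * (b * (4 * x)) ≡ 8 * b * x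
  swap₂ = solve-∀

-- As `a ≤ b`, the factor `b ^ k` dominates `a ^ k` and cancels. With `quotient-^-≤` this passes
-- from `c / ε ^ k ≤ m` to `c ≤ m` when `ε` is below 1.
^-ratio-≤ : ∀ c m k {a b} → a ≤ b → 1 ≤ b → c * b ^ k ≤ a ^ k * m → c ≤ m
^-ratio-≤ c m k {a} {b@(suc _)} a≤b _ le = *-cancelʳ-≤ c m (b ^ k) {{m^n≢0 b k}}
  (≤-trans le (≤-trans (*-monoˡ-≤ m (^-monoˡ-≤ k a≤b)) (≤-reflexive (*-comm (b ^ k) m))))

module _ (em : ExcludedMiddle 0ℓ) (P : PermutationProperty) (hereditary : Hereditary P)
         {M K q′ r : ℕ} (r+q≡M : r + suc q′ ≡ M) (q≤r : suc q′ ≤ r) (r≤1+q : r ≤ suc (suc q′))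
         (4≤M : 4 ≤ M) (maxK : IsMaxK* P M K) where

  private
    Q = suc q′

    1≤M : 1 ≤ M
    1≤M = ≤-trans (s≤s z≤n) 4≤M

    1≤K : 1 ≤ K
    1≤K = maxK .proj₁ .proj₂ .proj₁ .proj₁

    2q≤M : 2 * Q ≤ M
    2q≤M = subst (2 * Q ≤_) r+q≡M (+-mono-≤ q≤r (≤-reflexive (+-identityʳ Q)))

    M≤2[1+q] : M ≤ 2 * suc Q
    M≤2[1+q] = subst (_≤ 2 * suc Q) r+q≡M
      (+-mono-≤ r≤1+q (≤-trans (n≤1+n Q) (≤-reflexive (sym (+-identityʳ (suc Q))))))

  -- Excluded middle settles the question about all reweightings; an algorithm is charged for its
  -- queries only.
  decide : ∀ {n} → Vec (Fin n × Fin n) Q → Bool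
  decide pairs = does (em {Accepts P pairs})

  accepts-members : ∀ {n} (π : Permutation′ (suc n)) → 32 * M ^ 5 * K ≤ suc n → P (suc n) π →
    3 * ∑ᵛ Q (λ xs → 𝟙 (¬? (decide (points π xs) Bool.≟ true))) ≤ suc n ^ Q
  accepts-members {n} π long Pπ = *-cancelˡ-≤ N (begin
    N * (3 * misses)                              ≡⟨ rearrange N misses ⟩
    3 * (N * misses)                              ≤⟨ *-monoʳ-≤ 3 (*-monoʳ-≤ N (∑ᵛ-mono Q (λ xs →
                                                       𝟙-mono (¬? (decide (points π xs) Bool.≟ true)) (¬? (good? xs)) (missed xs)))) ⟩
    3 * (N * ∑ᵛ Q (λ xs → 𝟙 (¬? (good? xs))))     ≤⟨ *-monoʳ-≤ 3 (count-bad w strip-count Q) ⟩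
    3 * (N ^ Q * (Q * (M² * M² * K) + Q * Q * w))   ≡⟨ rearrange (N ^ Q) _ ⟨
    N ^ Q * (3 * (Q * (M² * M² * K) + Q * Q * w))   ≤⟨ *-monoʳ-≤ (N ^ Q)
                                                       (bad-samples-≤ {N} {M} {K} {Q} {w} 2q≤M 1≤K 4≤M long (parts-≤ N M²)) ⟩
    N ^ Q * N                                     ≡⟨ *-comm (N ^ Q) N ⟩
    N * N ^ Q                                     ∎)
    where
    open ≤-Reasoning
    N = suc n
    M² = M * M
    instance
      m-nonZero : NonZero M²
      m-nonZero = >-nonZero (*-mono-≤ 1≤M 1≤M)
    -- `M * M` strips of this width cover all `N` positions, and rounding up adds at most `M * M` in
    -- total.
    w = suc (N / M²)
    quotient< : ∀ (i : Fin N) → toℕ i / w < M²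
    quotient< i = m<n*o⇒m/o<n (<-≤-trans (Fin.toℕ<n i) (≤-parts N M²))
    strip : Fin N → Fin M²
    strip i = fromℕ< (quotient< i)
    strip-mono : ∀ {i j} → i Fin.≤ j → strip i Fin.≤ strip j
    strip-mono {i} {j} i≤j = subst₂ _≤_
      (sym (Fin.toℕ-fromℕ< (quotient< i))) (sym (Fin.toℕ-fromℕ< (quotient< j))) (/-monoˡ-≤ w i≤j)
    strip-count : ∀ c → count (λ j → strip j Fin.≟ c) ≤ w
    strip-count c = count-interval-≤ (λ j → strip j Fin.≟ c) (toℕ c * w) w λ { j refl →
      let c≡ = Fin.toℕ-fromℕ< (quotient< j) in
      subst (λ t → t * w ≤ toℕ j) (sym c≡) (m/n*n≤m (toℕ j) w) ,
      subst₂ (λ t u → t < u * w + w) (sym (m≡m%n+[m/n]*n (toℕ j) w)) (sym c≡)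
        (subst (toℕ j % w + toℕ j / w * w <_) (+-comm w _) (+-monoˡ-< _ (m%n<n (toℕ j) w))) }
    open Grid π strip strip-mono K
    misses = ∑ᵛ Q (λ xs → 𝟙 (¬? (decide (points π xs) Bool.≟ true)))
    missed : ∀ xs → decide (points π xs) ≢ true → ¬ Good xs
    missed xs rejected good = rejected (dec-true em (Accepts-points {P = P} π xs
      (Good⇒realises w strip-count em {P} hereditary r
        (subst (λ T → IsMaxK* P T K) (sym r+q≡M) maxK) Pπ (s≤s z≤n) (s≤s z≤n)
        (subst (λ T → M² * M² * K + T * (2 * w) < N) (sym r+q≡M)
          (room-to-extend {N} {M} {K} {Q} {w} 2q≤M 1≤K 4≤M long (parts-≤ N M²))) xs good)))
    rearrange : ∀ x y → x * (3 * y) ≡ 3 * (x * y)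
    rearrange = solve-∀

  -- Markov's inequality: an accepted sample costs at least `a * N * n / (8 * b)`, where
  -- `N = suc n`, whereas `nearest-average` bounds the cost of all samples together.
  rejects-far : ∀ {n} (π : Permutation′ (suc n)) {d p a b} → 32 * M ^ 5 * K ≤ suc n →
    IsDistance P π d → p ℚ.< d → 0ℚ ℚ.< p → 1 ≤ a → 1 ≤ b → a ≤ b → ι b ℚ.* p ≡ ι a →
    20000 * b ^ 2 ≤ a ^ 2 * M →
    3 * ∑ᵛ Q (λ xs → 𝟙 (¬? (decide (points π xs) Bool.≟ false))) ≤ suc n ^ Q
  rejects-far {n} π {a = a} {b} long isDistance p<d 0<p 1≤a 1≤b a≤b p≡a/b large =
    *-cancelˡ-≤ (N * (a * n * q⁺))
      {{>-nonZero (*-mono-≤ {1} {N} (s≤s z≤n) (*-mono-≤ (*-mono-≤ 1≤a 1≤n) (s≤s z≤n)))}} (begin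
      N * (a * n * q⁺) * (3 * misses)            ≡⟨ lhs N a n q⁺ misses ⟩
      3 * (q⁺ * (a * (N * n) * misses))          ≤⟨ *-monoʳ-≤ 3 (*-monoʳ-≤ q⁺ markov) ⟩
      3 * (q⁺ * (8 * b * ∑ᵛ Q cost))             ≡⟨ middle q⁺ b (∑ᵛ Q cost) ⟩
      24 * b * (q⁺ * ∑ᵛ Q cost)                  ≤⟨ *-monoʳ-≤ (24 * b) (nearest-average π Q s h (≤-parts N s)) ⟩
      24 * b * (N * N ^ Q * (3 * N * s + q⁺ * h))
                                                 ≡⟨ commute (24 * b) (N * N ^ Q) (3 * N * s + q⁺ * h) ⟩
      N * N ^ Q * (24 * b * (3 * N * s + q⁺ * h))
                                                 ≤⟨ *-monoʳ-≤ (N * N ^ Q)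
                                                     (sampling-error-≤ {a} {b} {M} {q⁺} {n} a≤b M≤2[1+q] large 32M≤N 1≤M) ⟩
      N * N ^ Q * (a * n * q⁺)                   ≡⟨ rhs N (N ^ Q) (a * n * q⁺) ⟩
      N * (a * n * q⁺) * N ^ Q                   ∎)
    where
    open ≤-Reasoning
    N = suc n
    q⁺ = suc Q
    instance
      a-nonZero : NonZero a
      a-nonZero = >-nonZero 1≤a
    32M≤N : 32 * M ≤ N
    32M≤N = ≤-trans (≤-reflexive (one M))
      (≤-trans (*-mono-≤ (*-monoʳ-≤ 32 (^-monoʳ-≤ M {{>-nonZero 1≤M}} {1} {5} (s≤s z≤n))) 1≤K) long)
      where
      one : ∀ M → 32 * M ≡ 32 * (M * 1) * 1
      one = solve-∀
    -- This excludes length 1, so that the factor `n`, which is `N - 1`, can be cancelled.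
    1≤n : 1 ≤ n
    1≤n = s≤s⁻¹ (≤-trans (*-mono-≤ {2} {32} (m≤m+n 2 30) 1≤M) 32M≤N)
    s = strips {a} {b} {M} {q⁺} {n} a≤b M≤2[1+q] large 32M≤N 1≤M
    h = height {a} {b} {M} {q⁺} {n} a≤b M≤2[1+q] large 32M≤N 1≤M
    cost : Vec (Fin N) Q → ℕ
    cost xs = sum (λ i → nearest π i xs)
    missed? = λ xs → ¬? (decide (points π xs) Bool.≟ false)
    misses = ∑ᵛ Q (λ xs → 𝟙 (missed? xs))
    accepted : ∀ xs → decide (points π xs) ≢ false → Accepts P (points π xs)
    accepted xs missed with em {Accepts P (points π xs)}
    ... | yes acc = acc
    ... | no _ = contradiction refl missed
    costly : ∀ xs → a * (N * n) * 𝟙 (missed? xs) ≤ 8 * b * cost xs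
    costly xs = *-𝟙-bound (a * (N * n)) (missed? xs) λ missed →
      accepted-far⇒costly em {P} π isDistance p<d 0<p 1≤b p≡a/b xs (accepted xs missed)
    markov : a * (N * n) * misses ≤ 8 * b * ∑ᵛ Q cost
    markov = subst₂ _≤_ (∑ᵛ-*ˡ Q (a * (N * n)) (λ xs → 𝟙 (missed? xs))) (∑ᵛ-*ˡ Q (8 * b) cost) (∑ᵛ-mono Q costly)
    lhs : ∀ N a n Q m → N * (a * n * Q) * (3 * m) ≡ 3 * (Q * (a * (N * n) * m))
    lhs = solve-∀
    middle : ∀ Q b c → 3 * (Q * (8 * b * c)) ≡ 24 * b * (Q * c)
    middle = solve-∀
    commute : ∀ x y z → x * (y * z) ≡ y * (x * z)
    commute = solve-∀
    rhs : ∀ x y z → x * y * z ≡ x * z * y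
    rhs = solve-∀

  module _ (ε : ℝ≥0) {{ε>0 : Positive ε}} (20000/ε²≤M : fromℕᵣ 20000 /ᵣ (ε ^ᵣ 2) ≤ᵣ fromℕᵣ M)
           {p} (p<1 : p ℚ.< 1ℚ) (p∉ε : ¬ Below ε p) where

    private
      n₀ = fromℕᵣ (32 * M ^ 5 * K) /ᵣ (ε ^ᵣ 3)

      long : ∀ {N} → n₀ ≤ᵣ fromℕᵣ N → 32 * M ^ 5 * K ≤ N
      long {N} n₀≤N with fraction p (∉-> ε (ε>0 .0<x) p∉ε)
      ... | a , b , _ , 1≤b , e = ^-ratio-≤ (32 * M ^ 5 * K) N 3 {a} {b} (fraction-<1 {p} {a} {b} p<1 1≤b e) 1≤b
                                    (quotient-^-≤ (32 * M ^ 5 * K) N 3 ε {p} {a} {b} n₀≤N p∉ε e)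

      rejects : ∀ {n} (π : Permutation′ (suc n)) → 32 * M ^ 5 * K ≤ suc n → Far P ε π →
                3 * ∑ᵛ Q (λ xs → 𝟙 (¬? (decide (points π xs) Bool.≟ false))) ≤ suc n ^ Q
      rejects π long (d , isDistance , p′ , p′<d , p′∉ε) with fraction p′ (∉-> ε (ε>0 .0<x) p′∉ε)
      ... | a , b , 1≤a , 1≤b , e =
        -- The rational `p′` between `ε` and the distance `d` replaces `ε`; `d ≤ 1` gives `a ≤ b`.
        rejects-far π {d} {p′} {a} {b} long isDistance p′<d (∉-> ε (ε>0 .0<x) p′∉ε) 1≤a 1≤b
          (fraction-<1 {p′} {a} {b} (ℚ.<-≤-trans p′<d (distance≤1 {P = P} isDistance)) 1≤b e) e
          (quotient-^-≤ 20000 M 2 ε {p′} {a} {b} 20000/ε²≤M p′∉ε e)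

    tester : Tester P ε M n₀
    tester = record
      { algorithm = algorithm
      ; accepts = λ { {suc n} π _ n₀≤n Pπ → likely π Q q≤M decide true (accepts-members π (long n₀≤n) Pπ) }
      ; rejects = λ { {suc n} π _ n₀≤n far → likely π Q q≤M decide false (rejects π (long n₀≤n) far) }
      }
      where
      q≤M : Q ≤ M
      q≤M = subst (Q ≤_) r+q≡M (m≤n+m Q r)
      algorithm : ∀ n → Algorithm n M
      -- Length 0 offers no position to sample; the guarantees of a tester start at length 1.
      algorithm zero    = output true
      algorithm (suc n) = sample Q q≤M decide

halves : ∀ M → 4 ≤ M → ∃[ q ] ∃[ r ] r + suc q ≡ M × suc q ≤ r × r ≤ suc (suc q)
halves M 4≤M = go ⌊ M /2⌋ (trans (+-comm ⌈ M /2⌉ ⌊ M /2⌋) (⌊n/2⌋+⌈n/2⌉≡n M))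
                  (⌊n/2⌋≤⌈n/2⌉ M) (⌊n/2⌋-mono (n≤1+n (suc M)))
  where
  go : ∀ {r} q → r + q ≡ M → q ≤ r → r ≤ suc q → ∃[ q ] ∃[ r ] r + suc q ≡ M × suc q ≤ r × r ≤ suc (suc q)
  go zero    r+q≡M _ r≤1 = contradiction (subst (4 ≤_) (sym r+q≡M) 4≤M) (<⇒≱ (≤-<-trans (+-monoˡ-≤ 0 r≤1) (m≤m+n 2 2)))
  go (suc q) r+q≡M q≤r r≤1+q = q , _ , r+q≡M , q≤r , r≤1+q

theorem1p8 : ExcludedMiddle 0ℓ →
    (P : PermutationProperty) → Hereditary P →
    (ε : ℝ≥0) {{ε>0 : Positive ε}} →
    (M : ℕ) → IsCeiling (fromℕᵣ 20000 /ᵣ (ε ^ᵣ 2)) M →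
    (K : ℕ) → IsMaxK* P M K →
    Tester P ε M (fromℕᵣ (32 * M ^ 5 * K) /ᵣ (ε ^ᵣ 3))
theorem1p8 em P hereditary ε {{ε>0}} M (20000/ε²≤M , _) K maxK = split em
  where
  split : Dec (∃[ p ] p ℚ.< 1ℚ × ¬ Below ε p) → Tester P ε M (fromℕᵣ (32 * M ^ 5 * K) /ᵣ (ε ^ᵣ 3))
  -- No rational below 1 bounds `ε` from above, so `ε` is at least 1. As distances are at most 1, no
  -- permutation is far and constant acceptance is a tester.
  split (no ∄) = record
    { algorithm = λ _ → output true
    ; accepts = λ _ _ _ _ → ratio≤1 {2} 3 (m≤m+n 2 1)
    ; rejects = λ { π _ _ (d , isDistance , p , p<d , p∉ε) →
        contradiction (p , ℚ.<-≤-trans p<d (distance≤1 {P = P} isDistance) , p∉ε) ∄ }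
    }
  split (yes (p , p<1 , p∉ε)) =
    let q , r , r+q≡M , q≤r , r≤1+q = halves M 4≤M
    in tester em P hereditary {M} {K} {q} {r} r+q≡M q≤r r≤1+q 4≤M maxK ε {{ε>0}} 20000/ε²≤M {p} p<1 p∉ε
    where
    -- As `ε` is below 1, even 20000 is at most `M`. The bound 4 makes the sample nonempty and
    -- leaves room for its extension.
    4≤M : 4 ≤ M
    4≤M with fraction p (∉-> ε (ε>0 .0<x) p∉ε)
    ... | a , b , _ , 1≤b , e = ≤-trans (m≤m+n 4 19996)
      (^-ratio-≤ 20000 M 2 {a} {b} (fraction-<1 {p} {a} {b} p<1 1≤b e) 1≤b
        (quotient-^-≤ 20000 M 2 ε {p} {a} {b} 20000/ε²≤M p∉ε e))
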